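{- For every sufficiently large constant $C>0$ and every sufficiently small constant $\varepsilon>0$ there is a constant $c>0$ such that for every $n$ the following holds. Every sketch $\mathrm{sk}(A)$ for $n\times n$ positive semidefinite matrices $A$ that satisfies the ``for all'' guarantee with relative approximation $\varepsilon$ (with constant probability of success, $0.9$), even if all entries of $A$ are promised to be in the range $\{ -1,-1+1/n^C,-1+2/n^C,\ldots,1-1/n^C,1\}$, must use at least $c\,n^2$ bits of space.
   Context: A sketch consists of a (possibly randomized) map $A\mapsto\mathrm{sk}(A)$ to bit strings and an estimation procedure $\mathrm{est}$ that sees only the query $x\in\mathbb R^n$ and $\mathrm{sk}(A)$ (and possibly shared random bits). It satisfies the ``for all'' guarantee with relative approximation $\varepsilon$ and success probability $p$ if for every admissible matrix $A$, with probability at least $p$, simultaneously for all $x\in\mathbb R^n$: $(1-\varepsilon)x^TAx\le\mathrm{est}(x,\mathrm{sk}(A))\le(1+\varepsilon)x^TAx$. The space is the worst-case length of $\mathrm{sk}(A)$ over all admissible $A$ and all random choices. -}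

module Defs where

open import Data.Bool.Base using (Bool)
open import Data.Fin.Base using (Fin; toℕ)
open import Data.Fin.Properties using (nonZeroIndex)
open import Data.Integer.Base as ℤ using (ℤ)
open import Data.List.Base using (List; length)
open import Data.Nat.Base as ℕ using (ℕ; suc)
import Data.Nat.Properties as ℕ
open import Data.Product.Base using (Σ-syntax; ∃-syntax; _×_; _,_)
open import Data.Rational.Base as ℚ using (ℚ; 0ℚ; 1ℚ; ½)
import Data.Rational.Properties as ℚ
open import Data.Rational.Solver using (module +-*-Solver)
open import Data.Vec.Functional using (Vector; foldr)
open import Level using (0ℓ)
open import Relation.Binary.PropositionalEquality
  using (_≡_; _≢_; refl; sym; trans; cong; cong₂; subst)
open import Relation.Unary using (Pred; U; ∁; _⊆_; _≐_; _⊥_; ⋃)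

open +-*-Solver using (solve; _:=_; _:+_; _:*_; _:-_; :-_; con)

------------------------------------------------------------------------
-- Real numbers, as Cauchy sequences of rationals

Eventually : Pred ℕ 0ℓ → Set
Eventually Q = ∃[ N ] (∀ n → N ℕ.≤ n → Q n)

Cauchy : (ℕ → ℚ) → Set
Cauchy a = ∀ δ → 0ℚ ℚ.< δ →
  ∃[ N ] (∀ m n → N ℕ.≤ m → N ℕ.≤ n → ℚ.∣ a m ℚ.- a n ∣ ℚ.≤ δ)

record ℝ : Set where
  constructor mkℝ
  field
    seq    : ℕ → ℚ
    cauchy : Cauchy seq

open ℝ public

infix 4 _≈_ _≤_ _<_

-- The equality of real numbers; distinct sequences can represent the same
-- number, so functions of real numbers are required to respect it.
_≈_ : ℝ → ℝ → Set
x ≈ y = ∀ δ → 0ℚ ℚ.< δ → Eventually λ n → ℚ.∣ seq x n ℚ.- seq y n ∣ ℚ.≤ δ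

_≤_ : ℝ → ℝ → Set
x ≤ y = ∀ δ → 0ℚ ℚ.< δ → Eventually λ n → seq x n ℚ.≤ seq y n ℚ.+ δ

_<_ : ℝ → ℝ → Set
x < y = ∃[ δ ] 0ℚ ℚ.< δ × Eventually λ n → seq x n ℚ.+ δ ℚ.≤ seq y n

-- Abstract, so that normalising a term of type ℝ does not unfold the moduli.
abstract
  private
    half-pos : ∀ {δ} → 0ℚ ℚ.< δ → 0ℚ ℚ.< ½ ℚ.* δ
    half-pos {δ} 0<δ = ℚ.positive⁻¹ (½ ℚ.* δ) {{ℚ.pos*pos⇒pos ½ δ {{ℚ.positive 0<δ}}}}

    half+half : ∀ δ → ½ ℚ.* δ ℚ.+ ½ ℚ.* δ ≡ δ
    half+half δ = trans (sym (ℚ.*-distribʳ-+ δ ½ ½)) (ℚ.*-identityˡ δ)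

    p≤q+p : ∀ p q .{{_ : ℚ.NonNegative q}} → p ℚ.≤ q ℚ.+ p
    p≤q+p p q = subst (ℚ._≤ q ℚ.+ p) (ℚ.+-identityˡ p)
      (ℚ.+-monoˡ-≤ p (ℚ.nonNegative⁻¹ q))

    const-cauchy : ∀ q → Cauchy (λ _ → q)
    const-cauchy q δ 0<δ = 0 , λ _ _ _ _ →
      subst (λ t → ℚ.∣ t ∣ ℚ.≤ δ) (sym (ℚ.+-inverseʳ q)) (ℚ.<⇒≤ 0<δ)

    +-cauchy : ∀ {a b} → Cauchy a → Cauchy b → Cauchy (λ n → a n ℚ.+ b n)
    +-cauchy {a} {b} ca cb δ 0<δ
      with M , M-ok ← ca (½ ℚ.* δ) (half-pos 0<δ)
         | N , N-ok ← cb (½ ℚ.* δ) (half-pos 0<δ)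
      = M ℕ.⊔ N , λ m n m≥ n≥ → begin
          ℚ.∣ (a m ℚ.+ b m) ℚ.- (a n ℚ.+ b n) ∣
            ≡⟨ cong ℚ.∣_∣ (solve 4 (λ p q r s →
                 (p :+ q) :- (r :+ s) := (p :- r) :+ (q :- s)) refl
                 (a m) (b m) (a n) (b n)) ⟩
          ℚ.∣ (a m ℚ.- a n) ℚ.+ (b m ℚ.- b n) ∣
            ≤⟨ ℚ.∣p+q∣≤∣p∣+∣q∣ (a m ℚ.- a n) (b m ℚ.- b n) ⟩
          ℚ.∣ a m ℚ.- a n ∣ ℚ.+ ℚ.∣ b m ℚ.- b n ∣
            ≤⟨ ℚ.+-mono-≤
                 (M-ok m n (ℕ.m⊔n≤o⇒m≤o M N m≥) (ℕ.m⊔n≤o⇒m≤o M N n≥))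
                 (N-ok m n (ℕ.m⊔n≤o⇒n≤o M N m≥) (ℕ.m⊔n≤o⇒n≤o M N n≥)) ⟩
          ½ ℚ.* δ ℚ.+ ½ ℚ.* δ
            ≡⟨ half+half δ ⟩
          δ ∎
      where open ℚ.≤-Reasoning

    neg-cauchy : ∀ {a} → Cauchy a → Cauchy (λ n → ℚ.- a n)
    neg-cauchy {a} ca δ 0<δ with N , N-ok ← ca δ 0<δ
      = N , λ m n m≥ n≥ → subst (ℚ._≤ δ)
          (trans (sym (ℚ.∣-p∣≡∣p∣ (a m ℚ.- a n)))
                 (cong ℚ.∣_∣ (solve 2 (λ p q → :- (p :- q) := (:- p) :- (:- q)) refl
                   (a m) (a n))))
          (N-ok m n m≥ n≥)

    eventually-bounded : ∀ {a} → Cauchy a →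
      ∃[ K ] ℚ.Positive K × Eventually λ n → ℚ.∣ a n ∣ ℚ.≤ K
    eventually-bounded {a} ca with N , N-ok ← ca 1ℚ (ℚ.positive⁻¹ 1ℚ)
      = 1ℚ ℚ.+ ℚ.∣ a N ∣
      , ℚ.pos+nonNeg⇒pos 1ℚ ℚ.∣ a N ∣ {{ℚ.∣-∣-nonNeg (a N)}}
      , N
      , λ n n≥ → begin
          ℚ.∣ a n ∣
            ≡⟨ cong ℚ.∣_∣ (solve 2 (λ p q → p := (p :- q) :+ q) refl (a n) (a N)) ⟩
          ℚ.∣ (a n ℚ.- a N) ℚ.+ a N ∣
            ≤⟨ ℚ.∣p+q∣≤∣p∣+∣q∣ (a n ℚ.- a N) (a N) ⟩
          ℚ.∣ a n ℚ.- a N ∣ ℚ.+ ℚ.∣ a N ∣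
            ≤⟨ ℚ.+-monoˡ-≤ ℚ.∣ a N ∣ (N-ok n N n≥ ℕ.≤-refl) ⟩
          1ℚ ℚ.+ ℚ.∣ a N ∣ ∎
      where open ℚ.≤-Reasoning

    ∣pq∣≤ : ∀ p q K η .{{_ : ℚ.NonNegative K}} →
      ℚ.∣ p ∣ ℚ.≤ K → ℚ.∣ q ∣ ℚ.≤ η → ℚ.∣ p ℚ.* q ∣ ℚ.≤ K ℚ.* η
    ∣pq∣≤ p q K η p≤K q≤η = subst (ℚ._≤ K ℚ.* η) (sym (ℚ.∣p*q∣≡∣p∣*∣q∣ p q))
      (ℚ.≤-trans (ℚ.*-monoʳ-≤-nonNeg ℚ.∣ q ∣ {{ℚ.∣-∣-nonNeg q}} p≤K)
                 (ℚ.*-monoˡ-≤-nonNeg K q≤η))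

    pq-rs : ∀ p q r s →
      p ℚ.* (q ℚ.- s) ℚ.+ s ℚ.* (p ℚ.- r) ≡ p ℚ.* q ℚ.- r ℚ.* s
    pq-rs = solve 4 (λ p q r s →
      p :* (q :- s) :+ s :* (p :- r) := p :* q :- r :* s) refl

    ∣pq-rs∣≤ : ∀ p q r s K η .{{_ : ℚ.NonNegative K}} →
      ℚ.∣ p ∣ ℚ.≤ K → ℚ.∣ s ∣ ℚ.≤ K →
      ℚ.∣ p ℚ.- r ∣ ℚ.≤ η → ℚ.∣ q ℚ.- s ∣ ℚ.≤ η →
      ℚ.∣ p ℚ.* q ℚ.- r ℚ.* s ∣ ℚ.≤ K ℚ.* η ℚ.+ K ℚ.* η
    ∣pq-rs∣≤ p q r s K η p≤K s≤K p-r≤η q-s≤η =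
      subst (λ t → ℚ.∣ t ∣ ℚ.≤ K ℚ.* η ℚ.+ K ℚ.* η) (pq-rs p q r s)
        (ℚ.≤-trans (ℚ.∣p+q∣≤∣p∣+∣q∣ (p ℚ.* (q ℚ.- s)) (s ℚ.* (p ℚ.- r)))
          (ℚ.+-mono-≤ (∣pq∣≤ p (q ℚ.- s) K η p≤K q-s≤η)
                      (∣pq∣≤ s (p ℚ.- r) K η s≤K p-r≤η)))

    ∃-η : ∀ K δ → ℚ.Positive K → 0ℚ ℚ.< δ →
      ∃[ η ] 0ℚ ℚ.< η × K ℚ.* η ℚ.+ K ℚ.* η ≡ δ
    ∃-η K δ K>0 0<δ = 1/K ℚ.* ½δ , 0<η , trans (cong₂ ℚ._+_ K*η K*η) (half+half δ)
      where
      ½δ : ℚ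
      ½δ = ½ ℚ.* δ

      1/K : ℚ
      1/K = (ℚ.1/ K) {{ℚ.pos⇒nonZero K {{K>0}}}}

      0<η : 0ℚ ℚ.< 1/K ℚ.* ½δ
      0<η = ℚ.positive⁻¹ (1/K ℚ.* ½δ)
        {{ℚ.pos*pos⇒pos 1/K {{ℚ.1/pos⇒pos K {{K>0}}}}
                        ½δ {{ℚ.positive (half-pos 0<δ)}}}}

      K*η : K ℚ.* (1/K ℚ.* ½δ) ≡ ½δ
      K*η = trans (sym (ℚ.*-assoc K 1/K ½δ))
           (trans (cong (ℚ._* ½δ) (ℚ.*-inverseʳ K {{ℚ.pos⇒nonZero K {{K>0}}}}))
                  (ℚ.*-identityˡ ½δ))

    common-bound : ∀ J L → ℚ.Positive J → ℚ.Positive L →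
      ∃[ K ] ℚ.Positive K × J ℚ.≤ K × L ℚ.≤ K
    common-bound J L J>0 L>0 =
      J ℚ.+ L , ℚ.pos+pos⇒pos J {{J>0}} L {{L>0}}
      , subst (J ℚ.≤_) (ℚ.+-comm L J) (p≤q+p J L {{ℚ.pos⇒nonNeg L {{L>0}}}})
      , p≤q+p L J {{ℚ.pos⇒nonNeg J {{J>0}}}}

    *-cauchy : ∀ {a b} → Cauchy a → Cauchy b → Cauchy (λ n → a n ℚ.* b n)
    *-cauchy {a} {b} ca cb δ 0<δ =
      let J , J>0 , M₀ , a≤J   = eventually-bounded ca
          L , L>0 , N₀ , b≤L   = eventually-bounded cb
          K , K>0 , J≤K , L≤K  = common-bound J L J>0 L>0
          η , 0<η , 2Kη≡δ      = ∃-η K δ K>0 0<δ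
          M₁ , a-ok            = ca η 0<η
          N₁ , b-ok            = cb η 0<η
      in (M₀ ℕ.⊔ N₀) ℕ.⊔ (M₁ ℕ.⊔ N₁) , λ m n m≥ n≥ →
        let m≥₀ = ℕ.m⊔n≤o⇒m≤o (M₀ ℕ.⊔ N₀) (M₁ ℕ.⊔ N₁) m≥
            m≥₁ = ℕ.m⊔n≤o⇒n≤o (M₀ ℕ.⊔ N₀) (M₁ ℕ.⊔ N₁) m≥
            n≥₀ = ℕ.m⊔n≤o⇒m≤o (M₀ ℕ.⊔ N₀) (M₁ ℕ.⊔ N₁) n≥
            n≥₁ = ℕ.m⊔n≤o⇒n≤o (M₀ ℕ.⊔ N₀) (M₁ ℕ.⊔ N₁) n≥
        in subst (ℚ.∣ a m ℚ.* b m ℚ.- a n ℚ.* b n ∣ ℚ.≤_) 2Kη≡δ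
          (∣pq-rs∣≤ (a m) (b m) (a n) (b n) K η {{ℚ.pos⇒nonNeg K {{K>0}}}}
            (ℚ.≤-trans (a≤J m (ℕ.m⊔n≤o⇒m≤o M₀ N₀ m≥₀)) J≤K)
            (ℚ.≤-trans (b≤L n (ℕ.m⊔n≤o⇒n≤o M₀ N₀ n≥₀)) L≤K)
            (a-ok m n (ℕ.m⊔n≤o⇒m≤o M₁ N₁ m≥₁) (ℕ.m⊔n≤o⇒m≤o M₁ N₁ n≥₁))
            (b-ok m n (ℕ.m⊔n≤o⇒n≤o M₁ N₁ m≥₁) (ℕ.m⊔n≤o⇒n≤o M₁ N₁ n≥₁)))

infixl 6 _+_ _-_
infixl 7 _*_
infix  8 -_

fromℚ : ℚ → ℝ
fromℚ q = mkℝ (λ _ → q) (const-cauchy q)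

fromℕ : ℕ → ℝ
fromℕ k = fromℚ (ℤ.+ k ℚ./ 1)

0ℝ 1ℝ : ℝ
0ℝ = fromℚ 0ℚ
1ℝ = fromℚ 1ℚ

_+_ : ℝ → ℝ → ℝ
x + y = mkℝ (λ n → seq x n ℚ.+ seq y n) (+-cauchy {seq x} {seq y} (cauchy x) (cauchy y))

-_ : ℝ → ℝ
- x = mkℝ (λ n → ℚ.- seq x n) (neg-cauchy {seq x} (cauchy x))

_-_ : ℝ → ℝ → ℝ
x - y = x + (- y)

_*_ : ℝ → ℝ → ℝ
x * y = mkℝ (λ n → seq x n ℚ.* seq y n) (*-cauchy {seq x} {seq y} (cauchy x) (cauchy y))

∑ : ∀ {n} → Vector ℝ n → ℝ
∑ = foldr _+_ 0ℝ

infix 4 _⟶_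

_⟶_ : (ℕ → ℝ) → ℝ → Set
a ⟶ l = ∀ δ → 0ℝ < δ → Eventually λ n → a n ≤ l + δ × l ≤ a n + δ

infix 4 _SumsTo_

_SumsTo_ : (ℕ → ℝ) → ℝ → Set
a SumsTo l = (λ n → ∑ λ (i : Fin n) → a (toℕ i)) ⟶ l

------------------------------------------------------------------------
-- Vectors, matrices, quadratic forms

Matrix : ℕ → Set
Matrix n = Fin n → Fin n → ℝ

infix 4 _≈ᵛ_ _≈ᵐ_

_≈ᵛ_ : ∀ {n} → Vector ℝ n → Vector ℝ n → Set
x ≈ᵛ y = ∀ i → x i ≈ y i

_≈ᵐ_ : ∀ {n} → Matrix n → Matrix n → Set
A ≈ᵐ B = ∀ i j → A i j ≈ B i j

-- quad A x is xᵀ A x.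
quad : ∀ {n} → Matrix n → Vector ℝ n → ℝ
quad A x = ∑ λ i → ∑ λ j → x i * A i j * x j

PositiveSemidefinite : ∀ {n} → Matrix n → Set
PositiveSemidefinite A = (∀ i j → A i j ≈ A j i) × (∀ x → 0ℝ ≤ quad A x)

-- The set {-1, -1 + 1/N, -1 + 2/N, …, 1 - 1/N, 1}.
Grid : (N : ℕ) .{{_ : ℕ.NonZero N}} → Pred ℝ 0ℓ
Grid N a = ∃[ k ] k ℕ.≤ 2 ℕ.* N × a ≈ fromℚ (ℚ.- 1ℚ ℚ.+ ℤ.+ k ℚ./ N)

-- An index i : Fin n provides the proof that n, hence n ^ C, is nonzero.
Admissible : (n C : ℕ) → Pred (Matrix n) 0ℓ
Admissible n C A =
  PositiveSemidefinite A ×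
  (∀ i j → Grid (n ℕ.^ C) {{ℕ.m^n≢0 n C {{nonZeroIndex i}}}} (A i j))

------------------------------------------------------------------------
-- Probability spaces

-- Kolmogorov's axioms. ℙ-∁ is stated separately because, without excluded
-- middle, E ∪ ∁ E need not be all of Ω and additivity does not yield it.
-- That ∅ is a null event follows from ℙ-∁ and ℙ-U.
record ProbabilitySpace : Set₂ where
  field
    Ω          : Set
    Measurable : Pred Ω 0ℓ → Set₁
    U-meas     : Measurable U
    ∁-meas     : ∀ {E} → Measurable E → Measurable (∁ E)
    ⋃-meas     : ∀ {E : ℕ → Pred Ω 0ℓ} →
                 (∀ i → Measurable (E i)) → Measurable (⋃ ℕ E)
    resp-meas  : ∀ {E F} → E ≐ F → Measurable E → Measurable F

    ℙ          : (E : Pred Ω 0ℓ) → Measurable E → ℝ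
    ℙ-cong     : ∀ {E F} (e : Measurable E) (f : Measurable F) →
                 E ≐ F → ℙ E e ≈ ℙ F f
    ℙ-nonneg   : ∀ {E} (e : Measurable E) → 0ℝ ≤ ℙ E e
    ℙ-U        : ℙ U U-meas ≈ 1ℝ
    ℙ-∁        : ∀ {E} (e : Measurable E) → ℙ (∁ E) (∁-meas e) ≈ 1ℝ - ℙ E e
    ℙ-⋃        : ∀ {E : ℕ → Pred Ω 0ℓ} (e : ∀ i → Measurable (E i)) →
                 (∀ i j → i ≢ j → E i ⊥ E j) →
                 (λ i → ℙ (E i) (e i)) SumsTo ℙ (⋃ ℕ E) (⋃-meas e)

  -- Q holds with probability at least p: Q, which need not itself be
  -- measurable, contains an event of probability at least p.
  WithProbability≥ : ℝ → Pred Ω 0ℓ → Set₁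
  WithProbability≥ p Q =
    Σ[ E ∈ Pred Ω 0ℓ ] Σ[ e ∈ Measurable E ] E ⊆ Q × p ≤ ℙ E e

------------------------------------------------------------------------
-- Sketches

-- 𝒜 is the class of admissible matrices. All randomness is drawn from one
-- space; sk sees the whole outcome ω and est only the shared part of it, so
-- private randomness of sk is allowed, as are no shared bits at all
-- (Shared = ⊤) and full sharing (Shared = Ω).
record Sketch {n : ℕ} (𝒜 : Pred (Matrix n) 0ℓ) : Set₂ where
  field
    randomness : ProbabilitySpace
  open ProbabilitySpace randomness public
  field
    Shared : Set
    shared : Ω → Shared

    sk     : (A : Matrix n) → 𝒜 A → Ω → List Bool
    est    : Vector ℝ n → List Bool → Shared → ℝ

    sk-cong  : ∀ {A B} (a : 𝒜 A) (b : 𝒜 B) → A ≈ᵐ B → ∀ ω → sk A a ω ≡ sk B b ω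
    est-cong : ∀ {x y} → x ≈ᵛ y → ∀ b σ → est x b σ ≈ est y b σ

  ForAllGuarantee : (ε p : ℝ) → Set₁
  ForAllGuarantee ε p = ∀ A (a : 𝒜 A) → WithProbability≥ p λ ω →
    ∀ x → (1ℝ - ε) * quad A x ≤ est x (sk A a ω) (shared ω)
        × est x (sk A a ω) (shared ω) ≤ (1ℝ + ε) * quad A x

  -- The worst-case length of the sketch is at most s.
  Space≤ : ℕ → Set
  Space≤ s = ∀ A (a : 𝒜 A) ω → length (sk A a ω) ℕ.≤ s

{-# OPTIONS --safe #-}

-- A relative approximation is exact on kernels: if xᵀAx = 0 and xᵀBx > 0, then
-- for ε ≤ 1/2 no output is good for both A and B at x. For a Boolean matrix X,
-- the form n⁻¹ ‖u + X v‖² in (u, v) has its entries on the grid, and its kernel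
-- { (- X v, v) } determines X. With u and v of length about n / 2 and the zero
-- matrix added, this gives 1 + 2^⌊n²/4⌋ matrices, of which any two that succeed
-- at the same outcome have distinct codes there. So at every outcome at most
-- 2^(s+1) - 1 of them succeed, while 9/10 of them succeed on average.

module Submission where

open import Defs
open import Algebra.Bundles using (CommutativeRing)
open import Data.Bool.Base using (Bool; true; false; _∧_)
open import Data.Empty using (⊥-elim) renaming (⊥ to ⊥₀)
open import Data.Fin.Base using (Fin; zero; suc; toℕ; combine; splitAt)
import Data.Fin.Properties as Fin
open import Data.Integer.Base as ℤ using (+_)
import Data.Integer.Properties as ℤ
import Data.Integer.Solver as ℤ
open import Data.List.Base using (List; []; _∷_; _++_; length; map)
open import Data.List.Membership.Propositional using (_∈_)
open import Data.List.Membership.Propositional.Properties using (∈-++⁺ˡ; ∈-++⁺ʳ; ∈-map⁺)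
open import Data.List.Properties using (length-map; length-++; length-removeAt)
open import Data.List.Relation.Unary.All as All using (All; []; _∷_)
import Data.List.Relation.Unary.All.Properties as All
open import Data.List.Relation.Unary.AllPairs as AllPairs using (AllPairs; []; _∷_)
import Data.List.Relation.Unary.AllPairs.Properties as AllPairs
open import Data.List.Relation.Unary.Any using (here; there; index; _─_)
open import Data.Nat.Base as ℕ using (ℕ; zero; suc)
import Data.Nat.Properties as ℕ
import Data.Nat.Solver as ℕ
open import Data.Product.Base using (_×_; ∃-syntax; _,_; proj₁; proj₂)
open import Data.Rational.Base as ℚ using (ℚ; 0ℚ; 1ℚ; ½; _/_)
import Data.Rational.Properties as ℚ
open import Data.Rational.Solver using (module +-*-Solver)
import Data.Rational.Unnormalised.Base as ℚᵘ
import Data.Rational.Unnormalised.Properties as ℚᵘ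
open import Data.Sum.Base using (_⊎_; inj₁; inj₂)
open import Data.Unit.Base using (⊤; tt)
open import Data.Vec.Base using (Vec; []; _∷_; lookup)
open import Data.Vec.Functional as Vector using (Vector)
open import Function.Base using (_∘_)
open import Level using (0ℓ)
open import Relation.Binary.Bundles using (Preorder)
open import Relation.Binary.Definitions using (tri<; tri≈; tri>)
open import Relation.Binary.PropositionalEquality
  using (_≡_; _≢_; refl; sym; trans; cong; cong₂; subst; subst₂; module ≡-Reasoning)
import Relation.Binary.Reasoning.Preorder as PreorderReasoning
open import Relation.Nullary.Decidable.Core using (does; yes; no; from-no)
open import Relation.Nullary.Negation.Core using (¬_; contradiction)
open import Relation.Unary using (Pred; U; ∁; _⊆_; _≐_; _⊥_; ⋃)

open +-*-Solver using (solve; _:=_; _:+_; _:*_; _:-_; :-_; con)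
open import Algebra.Properties.Semiring.Sum (CommutativeRing.semiring ℚ.+-*-commutativeRing)
  using (sum; sum-cong-≗; ∑-comm; *-distribˡ-sum; *-distribʳ-sum; sum-replicate-zero)

-- Real numbers

-- _≤_ and _≈_ unfold to Π-types that mention only sequences, so that their
-- arguments cannot be inferred and are explicit below.

-- At the chosen query the comparison is between 0 and a positive number, so the size of ε does not
-- enter the count, and c can be chosen independently of ε and C. Two matrices are always compared
-- at one outcome ω, where both runs see the same random bits, private or shared. The query may
-- depend on the pair because success covers all x at once. The zero matrix is there for n = 1: the
-- block X is then empty and leaves a single matrix, from which no bound follows. The probabilistic
-- part is shaped by the absence of excluded middle. Success at ω is not decidable, so the number of
-- successes is not a function of ω that could be averaged. Instead the sum of the probabilities is
-- bounded by splitting events along one another, through statements that are insensitive to double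
-- negation; `ℙ-∁` makes this legitimate, since it recovers a probability from the complement.

eventually-map₂ : ∀ {P Q R : Pred ℕ 0ℓ} → (∀ n → P n → Q n → R n) →
  Eventually P → Eventually Q → Eventually R
eventually-map₂ f (M , p) (N , q) = M ℕ.⊔ N , λ n n≥ →
  f n (p n (ℕ.m⊔n≤o⇒m≤o M N n≥)) (q n (ℕ.m⊔n≤o⇒n≤o M N n≥))

∃-half : ∀ δ → 0ℚ ℚ.< δ → ∃[ η ] 0ℚ ℚ.< η × η ℚ.+ η ≡ δ
∃-half δ 0<δ = ½ ℚ.* δ
  , ℚ.positive⁻¹ (½ ℚ.* δ) {{ℚ.pos*pos⇒pos ½ δ {{ℚ.positive 0<δ}}}}
  , trans (sym (ℚ.*-distribʳ-+ δ ½ ½)) (ℚ.*-identityˡ δ)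

p≤p+q : ∀ p {q} → 0ℚ ℚ.≤ q → p ℚ.≤ p ℚ.+ q
p≤p+q p 0≤q = subst (ℚ._≤ p ℚ.+ _) (ℚ.+-identityʳ p) (ℚ.+-monoʳ-≤ p 0≤q)

∣p-q∣≤r⇒p≤q+r : ∀ p q r → ℚ.∣ p ℚ.- q ∣ ℚ.≤ r → p ℚ.≤ q ℚ.+ r
∣p-q∣≤r⇒p≤q+r p q r h = begin
  p                        ≡⟨ solve 2 (λ p q → p := q :+ (p :- q)) refl p q ⟩
  q ℚ.+ (p ℚ.- q)          ≤⟨ ℚ.+-monoʳ-≤ q (p≤∣p∣ (p ℚ.- q)) ⟩
  q ℚ.+ ℚ.∣ p ℚ.- q ∣      ≤⟨ ℚ.+-monoʳ-≤ q h ⟩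
  q ℚ.+ r                  ∎
  where
  open ℚ.≤-Reasoning
  p≤∣p∣ : ∀ p → p ℚ.≤ ℚ.∣ p ∣
  p≤∣p∣ p with ℚ.∣p∣≡p∨∣p∣≡-p p | ℚ.≤-total 0ℚ p
  ... | inj₁ eq | _ = ℚ.≤-reflexive (sym eq)
  ... | inj₂ eq | inj₁ 0≤p = ℚ.≤-reflexive (sym (ℚ.0≤p⇒∣p∣≡p 0≤p))
  ... | inj₂ eq | inj₂ p≤0 = ℚ.≤-trans p≤0 (ℚ.0≤∣p∣ p)

p≤q+r⇒∣p-q∣≤r : ∀ p q r → p ℚ.≤ q ℚ.+ r → q ℚ.≤ p ℚ.+ r → ℚ.∣ p ℚ.- q ∣ ℚ.≤ r
p≤q+r⇒∣p-q∣≤r p q r p≤ q≤ with ℚ.∣p∣≡p∨∣p∣≡-p (p ℚ.- q)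
... | inj₁ eq = begin
  ℚ.∣ p ℚ.- q ∣            ≡⟨ eq ⟩
  p ℚ.- q                  ≤⟨ ℚ.+-monoˡ-≤ (ℚ.- q) p≤ ⟩
  q ℚ.+ r ℚ.- q            ≡⟨ solve 2 (λ q r → q :+ r :- q := r) refl q r ⟩
  r                        ∎
  where open ℚ.≤-Reasoning
... | inj₂ eq = begin
  ℚ.∣ p ℚ.- q ∣            ≡⟨ eq ⟩
  ℚ.- (p ℚ.- q)            ≡⟨ solve 2 (λ p q → :- (p :- q) := q :- p) refl p q ⟩
  q ℚ.- p                  ≤⟨ ℚ.+-monoˡ-≤ (ℚ.- p) q≤ ⟩
  p ℚ.+ r ℚ.- p            ≡⟨ solve 2 (λ q r → q :+ r :- q := r) refl p r ⟩
  r                        ∎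
  where open ℚ.≤-Reasoning

pointwise-≤ : ∀ x y → (∀ t → seq x t ℚ.≤ seq y t) → x ≤ y
pointwise-≤ x y h δ 0<δ = 0 , λ t _ → ℚ.≤-trans (h t) (p≤p+q (seq y t) (ℚ.<⇒≤ 0<δ))

≤-refl : ∀ x → x ≤ x
≤-refl x = pointwise-≤ x x λ _ → ℚ.≤-refl

≤-trans : ∀ x y z → x ≤ y → y ≤ z → x ≤ z
≤-trans x y z x≤y y≤z δ 0<δ with η , 0<η , refl ← ∃-half δ 0<δ =
  eventually-map₂ (λ t p q → begin
    seq x t                      ≤⟨ p ⟩
    seq y t ℚ.+ η                ≤⟨ ℚ.+-monoˡ-≤ η q ⟩
    seq z t ℚ.+ η ℚ.+ η          ≡⟨ ℚ.+-assoc (seq z t) η η ⟩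
    seq z t ℚ.+ (η ℚ.+ η)        ∎)
  (x≤y η 0<η) (y≤z η 0<η)
  where open ℚ.≤-Reasoning

≈⇒≤ : ∀ x y → x ≈ y → x ≤ y
≈⇒≤ x y x≈y δ 0<δ with N , h ← x≈y δ 0<δ =
  N , λ t t≥ → ∣p-q∣≤r⇒p≤q+r (seq x t) (seq y t) δ (h t t≥)

≤-antisym : ∀ x y → x ≤ y → y ≤ x → x ≈ y
≤-antisym x y x≤y y≤x δ 0<δ =
  eventually-map₂ (λ t → p≤q+r⇒∣p-q∣≤r (seq x t) (seq y t) δ) (x≤y δ 0<δ) (y≤x δ 0<δ)

pointwise-≈ : ∀ x y → (∀ t → seq x t ≡ seq y t) → x ≈ y
pointwise-≈ x y h = ≤-antisym x y
  (pointwise-≤ x y (ℚ.≤-reflexive ∘ h)) (pointwise-≤ y x (ℚ.≤-reflexive ∘ sym ∘ h))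

≈-sym : ∀ x y → x ≈ y → y ≈ x
≈-sym x y x≈y δ 0<δ with N , h ← x≈y δ 0<δ = N , λ t t≥ →
  subst (ℚ._≤ δ)
    (trans (sym (ℚ.∣-p∣≡∣p∣ (seq x t ℚ.- seq y t)))
      (cong ℚ.∣_∣ (solve 2 (λ p q → :- (p :- q) := q :- p) refl (seq x t) (seq y t))))
    (h t t≥)

≈-trans : ∀ x y z → x ≈ y → y ≈ z → x ≈ z
≈-trans x y z x≈y y≈z = ≤-antisym x z
  (≤-trans x y z (≈⇒≤ x y x≈y) (≈⇒≤ y z y≈z))
  (≤-trans z y x (≈⇒≤ z y (≈-sym y z y≈z)) (≈⇒≤ y x (≈-sym x y x≈y)))

≤-preorder : Preorder 0ℓ 0ℓ 0ℓ
≤-preorder = record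
  { Carrier = ℝ ; _≈_ = _≈_ ; _≲_ = _≤_
  ; isPreorder = record
    { isEquivalence = record
      { refl = λ {x} → pointwise-≈ x x λ _ → refl
      ; sym = λ {x} {y} → ≈-sym x y
      ; trans = λ {x} {y} {z} → ≈-trans x y z }
    ; reflexive = λ {x} {y} → ≈⇒≤ x y
    ; trans = λ {x} {y} {z} → ≤-trans x y z } }

+-mono-≤ : ∀ w x y z → w ≤ x → y ≤ z → w + y ≤ x + z
+-mono-≤ w x y z w≤x y≤z δ 0<δ with η , 0<η , refl ← ∃-half δ 0<δ =
  eventually-map₂ (λ t p q → begin
    seq w t ℚ.+ seq y t                    ≤⟨ ℚ.+-mono-≤ p q ⟩
    (seq x t ℚ.+ η) ℚ.+ (seq z t ℚ.+ η)
      ≡⟨ solve 3 (λ a b c → (a :+ c) :+ (b :+ c) := (a :+ b) :+ (c :+ c)) refl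
           (seq x t) (seq z t) η ⟩
    (seq x t ℚ.+ seq z t) ℚ.+ (η ℚ.+ η)    ∎)
  (w≤x η 0<η) (y≤z η 0<η)
  where open ℚ.≤-Reasoning

+-cong : ∀ w x y z → w ≈ x → y ≈ z → w + y ≈ x + z
+-cong w x y z w≈x y≈z = ≤-antisym (w + y) (x + z)
  (+-mono-≤ w x y z (≈⇒≤ w x w≈x) (≈⇒≤ y z y≈z))
  (+-mono-≤ x w z y (≈⇒≤ x w (≈-sym w x w≈x)) (≈⇒≤ z y (≈-sym y z y≈z)))

+-congˡ : ∀ x y z → y ≈ z → x + y ≈ x + z
+-congˡ x y z = +-cong x x y z (pointwise-≈ x x λ _ → refl)

+-assoc : ∀ x y z → x + y + z ≈ x + (y + z)
+-assoc x y z = pointwise-≈ (x + y + z) (x + (y + z)) λ t → ℚ.+-assoc (seq x t) (seq y t) (seq z t)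

+-identityʳ : ∀ x → x + 0ℝ ≈ x
+-identityʳ x = pointwise-≈ (x + 0ℝ) x λ t → ℚ.+-identityʳ (seq x t)

-- Undoes the complement rule `ℙ-∁`, through which probabilities are compared below.
x-y≤x-z⇒z≤y : ∀ x y z → x - y ≤ x - z → z ≤ y
x-y≤x-z⇒z≤y x y z h δ 0<δ with N , k ← h δ 0<δ = N , λ t t≥ →
  cancel (seq x t) (seq y t) (seq z t) (k t t≥)
  where
  open ℚ.≤-Reasoning
  cancel : ∀ p q r → p ℚ.- q ℚ.≤ p ℚ.- r ℚ.+ δ → r ℚ.≤ q ℚ.+ δ
  cancel p q r l = begin
    r                                      ≡⟨ solve 3 (λ p q r → r := (p :- q) :+ (q :+ r :- p)) refl p q r ⟩
    (p ℚ.- q) ℚ.+ (q ℚ.+ r ℚ.- p)          ≤⟨ ℚ.+-monoˡ-≤ (q ℚ.+ r ℚ.- p) l ⟩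
    (p ℚ.- r ℚ.+ δ) ℚ.+ (q ℚ.+ r ℚ.- p)
      ≡⟨ solve 4 (λ p q r δ → (p :- r :+ δ) :+ (q :+ r :- p) := q :+ δ) refl p q r δ ⟩
    q ℚ.+ δ                                ∎

≤-closed : ∀ x y → (∀ δ → 0ℚ ℚ.< δ → x ≤ y + fromℚ δ) → x ≤ y
≤-closed x y h δ 0<δ with η , 0<η , refl ← ∃-half δ 0<δ
  with N , k ← h η 0<η η 0<η
  = N , λ t t≥ → subst (seq x t ℚ.≤_) (ℚ.+-assoc (seq y t) η η) (k t t≥)

-- The order of ℚ is decidable, so contradiction is available: for q < m < p, the tolerance m - q
-- gives p ≤ m.
fromℚ-cancel-≤ : ∀ {p q} → fromℚ p ≤ fromℚ q → p ℚ.≤ q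
fromℚ-cancel-≤ {p} {q} h = ℚ.≮⇒≥ λ q<p →
  let m , q<m , m<p = ℚ.<-dense q<p
      0<m-q         = subst (ℚ._< m ℚ.- q) (ℚ.+-inverseʳ q) (ℚ.+-monoˡ-< (ℚ.- q) q<m)
      N , k         = h (m ℚ.- q) 0<m-q
  in ℚ.<-irrefl refl (ℚ.<-≤-trans m<p
       (subst (p ℚ.≤_) (solve 2 (λ q m → q :+ (m :- q) := m) refl q m) (k N ℕ.≤-refl)))

fromℚ-pos : ∀ {q} → 0ℚ ℚ.< q → 0ℝ < fromℚ q
fromℚ-pos {q} 0<q = q , 0<q , 0 , λ _ _ → ℚ.≤-reflexive (ℚ.+-identityˡ q)

module _ (a : ℕ → ℝ) (l x : ℝ) (a⟶l : a ⟶ l) (a≈x : Eventually λ n → a n ≈ x) where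

  private
    near : ∀ δ → 0ℚ ℚ.< δ → x ≤ l + fromℚ δ × l ≤ x + fromℚ δ
    near δ 0<δ with N , h ← eventually-map₂ (λ _ p q → p , q) (a⟶l (fromℚ δ) (fromℚ-pos 0<δ)) a≈x
      with (p , q) , a≈ ← h N ℕ.≤-refl
      = ≤-trans x (a N) (l + fromℚ δ) (≈⇒≤ x (a N) (≈-sym (a N) x a≈)) p
      , ≤-trans l (a N + fromℚ δ) (x + fromℚ δ) q
          (+-mono-≤ (a N) x (fromℚ δ) (fromℚ δ) (≈⇒≤ (a N) x a≈) (≤-refl (fromℚ δ)))

  -- Turns countable additivity into finite additivity: when all but two events are null, the
  -- partial sums are constant from the second on.
  ⟶-eventually-constant : l ≈ x
  ⟶-eventually-constant = ≤-antisym l x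
    (≤-closed l x λ δ 0<δ → proj₂ (near δ 0<δ))
    (≤-closed x l λ δ 0<δ → proj₁ (near δ 0<δ))

infixr 7 _·_

-- Iterated addition rather than `fromℕ k * x`, so that inductions on lists of events can peel off
-- one summand definitionally.
_·_ : ℕ → ℝ → ℝ
zero  · x = 0ℝ
suc k · x = x + k · x

·-mono-≤ : ∀ k x y → x ≤ y → k · x ≤ k · y
·-mono-≤ zero    x y x≤y = ≤-refl 0ℝ
·-mono-≤ (suc k) x y x≤y = +-mono-≤ x y (k · x) (k · y) x≤y (·-mono-≤ k x y x≤y)

·-distrib-+ : ∀ k x y → k · (x + y) ≈ k · x + k · y
·-distrib-+ k x y = pointwise-≈ (k · (x + y)) (k · x + k · y) λ t → go k t
  where
  go : ∀ k t → seq (k · (x + y)) t ≡ seq (k · x) t ℚ.+ seq (k · y) t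
  go zero    t = refl
  go (suc k) t = trans (cong (seq x t ℚ.+ seq y t ℚ.+_) (go k t))
    (solve 4 (λ a b c d → (a :+ b) :+ (c :+ d) := (a :+ c) :+ (b :+ d)) refl
      (seq x t) (seq y t) (seq (k · x) t) (seq (k · y) t))

-- `_/_` normalises by a gcd that does not reduce for a variable `k`; unnormalised rationals reduce
-- the claim to an identity of integers.
suc/1 : ∀ k → + suc k / 1 ≡ 1ℚ ℚ.+ + k / 1
suc/1 k = ℚ.toℚᵘ-injective (begin-equality
  ℚ.toℚᵘ (+ suc k / 1)                  ≃⟨ ℚ.toℚᵘ-fromℚᵘ (ℚᵘ.mkℚᵘ (+ suc k) 0) ⟩
  ℚᵘ.mkℚᵘ (+ suc k) 0                   ≃⟨ ℚᵘ.*≡* (cong (λ i → (+ 1 ℤ.+ i) ℤ.* + 1) (sym (ℤ.*-identityʳ (+ k)))) ⟩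
  ℚᵘ.1ℚᵘ ℚᵘ.+ ℚᵘ.mkℚᵘ (+ k) 0           ≃⟨ ℚᵘ.+-congʳ ℚᵘ.1ℚᵘ (ℚ.toℚᵘ-fromℚᵘ (ℚᵘ.mkℚᵘ (+ k) 0)) ⟨
  ℚ.toℚᵘ 1ℚ ℚᵘ.+ ℚ.toℚᵘ (+ k / 1)       ≃⟨ ℚ.toℚᵘ-homo-+ 1ℚ (+ k / 1) ⟨
  ℚ.toℚᵘ (1ℚ ℚ.+ + k / 1)               ∎)
  where open ℚᵘ.≤-Reasoning

·-fromℚ : ∀ k q t → seq (k · fromℚ q) t ≡ (+ k / 1) ℚ.* q
·-fromℚ zero    q t = sym (ℚ.*-zeroˡ q)
·-fromℚ (suc k) q t = begin
  q ℚ.+ seq (k · fromℚ q) t             ≡⟨ cong (q ℚ.+_) (·-fromℚ k q t) ⟩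
  q ℚ.+ (+ k / 1) ℚ.* q                 ≡⟨ solve 2 (λ q k → q :+ k :* q := (con 1ℚ :+ k) :* q) refl q (+ k / 1) ⟩
  (1ℚ ℚ.+ + k / 1) ℚ.* q                ≡⟨ cong (ℚ._* q) (suc/1 k) ⟨
  (+ suc k / 1) ℚ.* q                   ∎
  where open ≡-Reasoning

∈-─ : ∀ {A : Set} {x y : A} {xs} (x∈xs : x ∈ xs) → y ≢ x → y ∈ xs → y ∈ (xs ─ x∈xs)
∈-─ (here refl)  y≢x (here refl)  = contradiction refl y≢x
∈-─ (here refl)  y≢x (there y∈xs) = y∈xs
∈-─ (there x∈xs) y≢x (here refl)  = here refl
∈-─ (there x∈xs) y≢x (there y∈xs) = there (∈-─ x∈xs y≢x y∈xs)

-- Counting events in a probability space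

module Counting (𝒫 : ProbabilitySpace) where
  open ProbabilitySpace 𝒫
  open PreorderReasoning ≤-preorder

  record Event : Set₁ where
    constructor _,,_
    field
      holds      : Pred Ω 0ℓ
      measurable : Measurable holds

  open Event

  prob : Event → ℝ
  prob E = ℙ (holds E) (measurable E)

  sure : Event
  sure = U ,, U-meas

  not : Event → Event
  not E = ∁ (holds E) ,, ∁-meas (measurable E)

  private
    -- The axioms offer only countable unions, so a binary union is padded with the empty event,
    -- written as the complement of `sure` to be measurable.
    padded : Event → Event → ℕ → Event
    padded E F 0             = E
    padded E F 1             = F
    padded E F (suc (suc _)) = not sure

  infixl 7 _and_
  infixl 6 _or_

  _or_ : Event → Event → Event
  E or F = ⋃ ℕ (holds ∘ padded E F) ,, ⋃-meas (measurable ∘ padded E F)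

  -- Constructively this is the double negation of the intersection.
  _and_ : Event → Event → Event
  E and F = not (not E or not F)

  or-introˡ : ∀ E F {ω} → holds E ω → holds (E or F) ω
  or-introˡ E F e = 0 , e

  or-introʳ : ∀ E F {ω} → holds F ω → holds (E or F) ω
  or-introʳ E F f = 1 , f

  or-elim : ∀ E F {ω} {A : Set} → (holds E ω → A) → (holds F ω → A) → holds (E or F) ω → A
  or-elim E F f g (0 , e)           = f e
  or-elim E F f g (1 , e)           = g e
  or-elim E F f g (suc (suc _) , e) = ⊥-elim (e tt)

  and-intro : ∀ E F {ω} → holds E ω → holds F ω → holds (E and F) ω
  and-intro E F e f = or-elim (not E) (not F) (λ ¬e → ¬e e) (λ ¬f → ¬f f)

  and-elim : ∀ E F {ω} → holds (E and F) ω → ¬ (holds E ω → ¬ holds F ω)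
  and-elim E F ef h = ef (or-introˡ (not E) (not F) λ e → ef (or-introʳ (not E) (not F) (h e)))

  -- By `ℙ-∁`, events that agree up to double negation are equally probable. This is what makes the
  -- double negation in `_and_` harmless.
  prob-cong-∁ : ∀ E F → ∁ (holds E) ≐ ∁ (holds F) → prob E ≤ prob F
  prob-cong-∁ E F (E⊆F , F⊆E) = x-y≤x-z⇒z≤y 1ℝ (prob F) (prob E) (begin
    1ℝ - prob F   ≈⟨ ℙ-∁ (measurable F) ⟨
    prob (not F)  ≈⟨ ℙ-cong (measurable (not F)) (measurable (not E)) (F⊆E , E⊆F) ⟩
    prob (not E)  ≈⟨ ℙ-∁ (measurable E) ⟩
    1ℝ - prob E   ∎)

  prob-impossible : ∀ E → (∀ ω → ¬ holds E ω) → prob E ≈ 0ℝ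
  prob-impossible E ¬E = ≤-antisym (prob E) 0ℝ (x-y≤x-z⇒z≤y 1ℝ 0ℝ (prob E) (begin
    1ℝ - 0ℝ       ≈⟨ pointwise-≈ (1ℝ - 0ℝ) 1ℝ (λ _ → refl) ⟩
    1ℝ            ≈⟨ ℙ-U ⟨
    prob sure     ≈⟨ ℙ-cong U-meas (measurable (not E)) ((λ {ω} _ → ¬E ω) , _) ⟩
    prob (not E)  ≈⟨ ℙ-∁ (measurable E) ⟩
    1ℝ - prob E   ∎)) (ℙ-nonneg (measurable E))

  private
    partial-sums : ∀ E F n →
      ∑ (λ (i : Fin (2 ℕ.+ n)) → prob (padded E F (toℕ i))) ≈ prob E + prob F
    partial-sums E F n = begin-equality
      prob E + (prob F + rest n)  ≈⟨ +-assoc (prob E) (prob F) (rest n) ⟨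
      prob E + prob F + rest n    ≈⟨ +-congˡ (prob E + prob F) (rest n) 0ℝ (rest≈0 n) ⟩
      prob E + prob F + 0ℝ        ≈⟨ +-identityʳ (prob E + prob F) ⟩
      prob E + prob F             ∎
      where
      rest : ℕ → ℝ
      rest n = ∑ (λ (_ : Fin n) → prob (not sure))

      rest≈0 : ∀ n → rest n ≈ 0ℝ
      rest≈0 zero    = pointwise-≈ 0ℝ 0ℝ λ _ → refl
      rest≈0 (suc n) = begin-equality
        prob (not sure) + rest n  ≈⟨ +-congˡ (prob (not sure)) (rest n) 0ℝ (rest≈0 n) ⟩
        prob (not sure) + 0ℝ      ≈⟨ +-identityʳ (prob (not sure)) ⟩
        prob (not sure)           ≈⟨ prob-impossible (not sure) (λ _ ¬⊤ → ¬⊤ tt) ⟩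
        0ℝ                        ∎

  prob-or : ∀ E F → holds E ⊥ holds F → prob (E or F) ≈ prob E + prob F
  prob-or E F E⊥F = ⟶-eventually-constant
    (λ n → ∑ λ (i : Fin n) → prob (padded E F (toℕ i))) (prob (E or F)) (prob E + prob F)
    (ℙ-⋃ (measurable ∘ padded E F) disjoint)
    (2 , λ { (suc (suc n)) (ℕ.s≤s (ℕ.s≤s _)) → partial-sums E F n })
    where
    disjoint : ∀ i j → i ≢ j → holds (padded E F i) ⊥ holds (padded E F j)
    disjoint 0 0 i≢j _             = i≢j refl
    disjoint 0 1 _ (e , f)         = E⊥F (e , f)
    disjoint 1 0 _ (f , e)         = E⊥F (e , f)
    disjoint 1 1 i≢j _             = i≢j refl
    disjoint (suc (suc _)) _ _ (¬⊤ , _) = ¬⊤ tt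
    disjoint 0 (suc (suc _)) _ (_ , ¬⊤) = ¬⊤ tt
    disjoint 1 (suc (suc _)) _ (_ , ¬⊤) = ¬⊤ tt

  -- Without excluded middle, E and F need only cover G up to double negation.
  prob-partition : ∀ G E F → holds E ⊥ holds F →
    (∀ {ω} → ¬ holds G ω → ¬ holds E ω × ¬ holds F ω) →
    (∀ {ω} → ¬ holds E ω → ¬ holds F ω → ¬ holds G ω) →
    prob G ≈ prob E + prob F
  prob-partition G E F E⊥F ¬G⇒ ⇒¬G = begin-equality
    prob G            ≈⟨ ≤-antisym (prob G) (prob (E or F))
                           (prob-cong-∁ G (E or F) (to , from))
                           (prob-cong-∁ (E or F) G (from , to)) ⟩
    prob (E or F)     ≈⟨ prob-or E F E⊥F ⟩
    prob E + prob F   ∎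
    where
    to : ∁ (holds G) ⊆ ∁ (holds (E or F))
    to ¬g = or-elim E F (proj₁ (¬G⇒ ¬g)) (proj₂ (¬G⇒ ¬g))
    from : ∁ (holds (E or F)) ⊆ ∁ (holds G)
    from ¬ef = ⇒¬G (¬ef ∘ or-introˡ E F) (¬ef ∘ or-introʳ E F)

  -- Every goal left by `prob-partition` is a negation, so `and-elim`, which releases its two
  -- components only under a double negation, is enough and E need not be decided.
  prob-split : ∀ F E → prob F ≈ prob (F and E) + prob (F and not E)
  prob-split F E = prob-partition F (F and E) (F and not E)
    (λ (fe , f¬e) → and-elim F E fe (λ _ e → and-elim F (not E) f¬e (λ _ ¬e → ¬e e)))
    (λ ¬f → (λ fe → and-elim F E fe (λ f _ → ¬f f))
          , (λ f¬e → and-elim F (not E) f¬e (λ f _ → ¬f f)))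
    (λ ¬fe ¬f¬e f → ¬f¬e (and-intro F (not E) f λ e → ¬fe (and-intro F E f e)))

  -- `prob-split` for `F and G` would produce `(F and G) and E`; the induction on
  -- `expectation (F and E)` needs E to be joined to F first.
  prob-and-split : ∀ F E G →
    prob (F and G) ≈ prob ((F and E) and G) + prob ((F and not E) and G)
  prob-and-split F E G = prob-partition (F and G) ((F and E) and G) ((F and not E) and G)
    (λ (feg , f¬eg) →
      and-elim (F and E) G feg (λ fe _ →
      and-elim (F and not E) G f¬eg (λ f¬e _ →
      and-elim F E fe (λ _ e → and-elim F (not E) f¬e (λ _ ¬e → ¬e e)))))
    (λ ¬fg → (λ feg → and-elim (F and E) G feg (λ fe g →
                and-elim F E fe (λ f _ → ¬fg (and-intro F G f g))))
           , (λ f¬eg → and-elim (F and not E) G f¬eg (λ f¬e g →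
                and-elim F (not E) f¬e (λ f _ → ¬fg (and-intro F G f g)))))
    (λ ¬feg ¬f¬eg fg → and-elim F G fg (λ f g →
      ¬f¬eg (and-intro (F and not E) G
        (and-intro F (not E) f λ e → ¬feg (and-intro (F and E) G (and-intro F E f e) g)) g)))

  -- The expected number of events of the list that hold together with F.
  expectation : Event → List Event → ℝ
  expectation F []       = 0ℝ
  expectation F (E ∷ Es) = prob (F and E) + expectation F Es

  expectation-split : ∀ F E Es →
    expectation F Es ≈ expectation (F and E) Es + expectation (F and not E) Es
  expectation-split F E []       = pointwise-≈ 0ℝ (0ℝ + 0ℝ) λ _ → refl
  expectation-split F E (G ∷ Gs) = begin-equality
    prob (F and G) + expectation F Gs
      ≈⟨ +-cong (prob (F and G)) (prob (FE and G) + prob (F¬E and G))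
           (expectation F Gs) (expectation FE Gs + expectation F¬E Gs)
           (prob-and-split F E G) (expectation-split F E Gs) ⟩
    (prob (FE and G) + prob (F¬E and G)) + (expectation FE Gs + expectation F¬E Gs)
      ≈⟨ pointwise-≈
           ((prob (FE and G) + prob (F¬E and G)) + (expectation FE Gs + expectation F¬E Gs))
           ((prob (FE and G) + expectation FE Gs) + (prob (F¬E and G) + expectation F¬E Gs))
           (λ t → solve 4 (λ a b c d → (a :+ b) :+ (c :+ d) := (a :+ c) :+ (b :+ d)) refl
              (seq (prob (FE and G)) t) (seq (prob (F¬E and G)) t)
              (seq (expectation FE Gs) t) (seq (expectation F¬E Gs) t)) ⟩
    (prob (FE and G) + expectation FE Gs) + (prob (F¬E and G) + expectation F¬E Gs) ∎
    where
    FE F¬E : Event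
    FE  = F and E
    F¬E = F and not E

  -- At most k of the events hold, in a form that is stable under double negation
  -- and does not require the events to be decidable.
  AtMost : ℕ → List Event → Pred Ω 0ℓ
  AtMost _       []       ω = ⊤
  AtMost zero    (E ∷ Es) ω = ¬ holds E ω × AtMost zero Es ω
  AtMost (suc k) (E ∷ Es) ω =
    (holds E ω → AtMost k Es ω) × (¬ holds E ω → AtMost (suc k) Es ω)

  AtMost-stable : ∀ k Es {ω} → ¬ ¬ AtMost k Es ω → AtMost k Es ω
  AtMost-stable _       []       _ = tt
  AtMost-stable zero    (E ∷ Es) h =
    (λ e → h λ (¬e , _) → ¬e e) , AtMost-stable zero Es λ ¬a → h λ (_ , a) → ¬a a
  AtMost-stable (suc k) (E ∷ Es) h =
    (λ e → AtMost-stable k Es λ ¬a → h λ (a , _) → ¬a (a e)) ,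
    (λ ¬e → AtMost-stable (suc k) Es λ ¬a → h λ (_ , a) → ¬a (a ¬e))

  -- Induction on the list: F is split into F ∩ E, where only k - 1 of the other
  -- events can hold, and F ∩ ∁ E.
  expectation-bound : ∀ k F Es → (∀ {ω} → holds F ω → AtMost k Es ω) →
    expectation F Es ≤ k · prob F
  expectation-bound k F [] _ = begin
    0ℝ          ≈⟨ pointwise-≈ 0ℝ (k · 0ℝ) (λ t → sym (trans (·-fromℚ k 0ℚ t) (ℚ.*-zeroʳ (+ k / 1)))) ⟩
    k · 0ℝ      ≲⟨ ·-mono-≤ k 0ℝ (prob F) (ℙ-nonneg (measurable F)) ⟩
    k · prob F  ∎
  expectation-bound zero F (E ∷ Es) h = begin
    prob (F and E) + expectation F Es
      ≲⟨ +-mono-≤ (prob (F and E)) 0ℝ (expectation F Es) 0ℝ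
           (≈⇒≤ (prob (F and E)) 0ℝ (prob-impossible (F and E)
             λ ω fe → and-elim F E fe (λ f e → proj₁ (h f) e)))
           (expectation-bound zero F Es (proj₂ ∘ h)) ⟩
    0ℝ + 0ℝ     ≈⟨ +-identityʳ 0ℝ ⟩
    0ℝ          ∎
  expectation-bound (suc k) F (E ∷ Es) h = begin
    prob FE + expectation F Es
      ≈⟨ +-congˡ (prob FE) (expectation F Es) (expectation FE Es + expectation F¬E Es)
           (expectation-split F E Es) ⟩
    prob FE + (expectation FE Es + expectation F¬E Es)
      ≈⟨ +-assoc (prob FE) (expectation FE Es) (expectation F¬E Es) ⟨
    prob FE + expectation FE Es + expectation F¬E Es
      ≲⟨ +-mono-≤ (prob FE + expectation FE Es) (suc k · prob FE)
           (expectation F¬E Es) (suc k · prob F¬E)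
           (+-mono-≤ (prob FE) (prob FE) (expectation FE Es) (k · prob FE) (≤-refl (prob FE))
             -- `fe` yields E only under a double negation, which `AtMost-stable` absorbs.
             (expectation-bound k FE Es λ fe →
               AtMost-stable k Es λ ¬a → and-elim F E fe λ f e → ¬a (proj₁ (h f) e)))
           (expectation-bound (suc k) F¬E Es λ f¬e →
             AtMost-stable (suc k) Es λ ¬a → and-elim F (not E) f¬e λ f ¬e → ¬a (proj₂ (h f) ¬e)) ⟩
    suc k · prob FE + suc k · prob F¬E
      ≈⟨ ·-distrib-+ (suc k) (prob FE) (prob F¬E) ⟨
    suc k · (prob FE + prob F¬E)
      ≲⟨ ·-mono-≤ (suc k) (prob FE + prob F¬E) (prob F)
           (≈⇒≤ (prob FE + prob F¬E) (prob F)
             (≈-sym (prob F) (prob FE + prob F¬E) (prob-split F E))) ⟩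
    suc k · prob F ∎
    where
    FE F¬E : Event
    FE  = F and E
    F¬E = F and not E

  -- Double counting: `expectation sure Es` is bounded below event by event and above outcome by
  -- outcome.
  average-bound : ∀ k p Es → All (λ E → p ≤ prob E) Es → (∀ ω → AtMost k Es ω) →
    length Es · p ≤ k · 1ℝ
  average-bound k p Es p≤Es h = begin
    length Es · p        ≲⟨ below p≤Es ⟩
    expectation sure Es  ≲⟨ expectation-bound k sure Es (λ {ω} _ → h ω) ⟩
    k · prob sure        ≲⟨ ·-mono-≤ k (prob sure) 1ℝ (≈⇒≤ (prob sure) 1ℝ ℙ-U) ⟩
    k · 1ℝ               ∎
    where
    prob≤ : ∀ E → prob E ≤ prob (sure and E)
    prob≤ E = prob-cong-∁ E (sure and E)
      ( (λ ¬e sure∧e → and-elim sure E sure∧e λ _ → ¬e)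
      , (λ ¬sure∧e e → ¬sure∧e (and-intro sure E tt e)))

    below : ∀ {Es} → All (λ E → p ≤ prob E) Es → length Es · p ≤ expectation sure Es
    below []                   = ≤-refl 0ℝ
    below {E ∷ Es} (p≤E ∷ p≤Es) =
      +-mono-≤ p (prob (sure and E)) (length Es · p) (expectation sure Es)
        (≤-trans p (prob E) (prob (sure and E)) p≤E (prob≤ E)) (below p≤Es)

  -- When an event holds, its code is struck from `L`. The later events that hold have other codes,
  -- so theirs survive in the shorter list. When it fails, `L` is kept.
  pigeonhole : ∀ {ω} {I : Set} {B : Set} (event : I → Event) (code : I → B) k L is →
    length L ℕ.≤ k →
    All (λ i → holds (event i) ω → code i ∈ L) is →
    AllPairs (λ i j → holds (event i) ω → holds (event j) ω → code i ≢ code j) is →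
    AtMost k (map event is) ω
  pigeonhole event code k L [] _ _ _ = tt
  pigeonhole event code zero [] (i ∷ is) L≤k (i∈L ∷ is∈L) (_ ∷ distinct) =
    (λ e → contradiction (i∈L e) λ ()) , pigeonhole event code zero [] is L≤k is∈L distinct
  pigeonhole event code (suc k) L (i ∷ is) L≤k (i∈L ∷ is∈L) (i≢is ∷ distinct) =
    (λ e → pigeonhole event code k (L ─ i∈L e) is
       (subst (ℕ._≤ k) (sym (length-removeAt L (index (i∈L e)))) (ℕ.pred-mono-≤ L≤k))
       (All.zipWith (λ (i≢j , j∈L) f → ∈-─ (i∈L e) (i≢j e f ∘ sym) (j∈L f)) (i≢is , is∈L))
       distinct) ,
    (λ _ → pigeonhole event code (suc k) L is L≤k is∈L distinct)

-- Bit strings of bounded length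

strings : ℕ → List (List Bool)
strings zero    = [] ∷ []
strings (suc s) = [] ∷ map (true ∷_) (strings s) ++ map (false ∷_) (strings s)

∈-strings : ∀ s bs → length bs ℕ.≤ s → bs ∈ strings s
∈-strings zero    []           _           = here refl
∈-strings (suc s) []           _           = here refl
∈-strings (suc s) (true  ∷ bs) (ℕ.s≤s bs≤) = there (∈-++⁺ˡ (∈-map⁺ (true ∷_) (∈-strings s bs bs≤)))
∈-strings (suc s) (false ∷ bs) (ℕ.s≤s bs≤) =
  there (∈-++⁺ʳ (map (true ∷_) (strings s)) (∈-map⁺ (false ∷_) (∈-strings s bs bs≤)))

length-strings : ∀ s → suc (length (strings s)) ≡ 2 ℕ.^ suc s
length-strings zero    = refl
length-strings (suc s) = begin
  2 ℕ.+ length (map (true ∷_) ss ++ map (false ∷_) ss)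
    ≡⟨ cong (2 ℕ.+_) (trans (length-++ (map (true ∷_) ss))
         (cong₂ ℕ._+_ (length-map (true ∷_) ss) (length-map (false ∷_) ss))) ⟩
  2 ℕ.+ (length ss ℕ.+ length ss)
    ≡⟨ cong suc (ℕ.+-suc (length ss) (length ss)) ⟨
  suc (length ss) ℕ.+ suc (length ss)
    ≡⟨ cong₂ ℕ._+_ (length-strings s) (trans (length-strings s) (sym (ℕ.+-identityʳ _))) ⟩
  2 ℕ.^ suc (suc s) ∎
  where
  open ≡-Reasoning
  ss = strings s

-- Sketches determine kernels

-- Inequalities of reals hold only up to a tolerance. Tolerance ¼ on ε leaves 1 - ε ≥ ¼, so
-- eventually the product is at least δ/4, whereas tolerance δ/8 on the product would bound it by
-- δ/8.
1-ε*q≰0 : ∀ ε q → ε ≤ fromℚ ½ → 0ℝ < q → ¬ ((1ℝ - ε) * q ≤ 0ℝ)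
1-ε*q≰0 ε q ε≤½ (δ , 0<δ , δ≤q) h = contra
  where
  ¼ ⅛ : ℚ
  ¼ = + 1 / 4
  ⅛ = + 1 / 8

  0<⅛δ : 0ℚ ℚ.< ⅛ ℚ.* δ
  0<⅛δ = ℚ.positive⁻¹ (⅛ ℚ.* δ) {{ℚ.pos*pos⇒pos ⅛ δ {{ℚ.positive 0<δ}}}}

  absurd-at : ∀ e r → e ℚ.≤ ½ ℚ.+ ¼ → 0ℚ ℚ.+ δ ℚ.≤ r →
    (1ℚ ℚ.- e) ℚ.* r ℚ.≤ 0ℚ ℚ.+ ⅛ ℚ.* δ → ⊥₀
  absurd-at e r e≤ δ≤r ≤⅛δ =
    from-no (¼ ℚ.≤? ⅛) (ℚ.*-cancelʳ-≤-pos δ {{ℚ.positive 0<δ}} (begin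
      ¼ ℚ.* δ              ≡⟨ cong (¼ ℚ.*_) (ℚ.+-identityˡ δ) ⟨
      ¼ ℚ.* (0ℚ ℚ.+ δ)     ≤⟨ ℚ.*-monoˡ-≤-nonNeg ¼ δ≤r ⟩
      ¼ ℚ.* r              ≤⟨ ℚ.*-monoʳ-≤-nonNeg r {{ℚ.nonNegative 0≤r}}
                                (ℚ.+-monoʳ-≤ 1ℚ (ℚ.neg-antimono-≤ e≤)) ⟩
      (1ℚ ℚ.- e) ℚ.* r     ≤⟨ ≤⅛δ ⟩
      0ℚ ℚ.+ ⅛ ℚ.* δ       ≡⟨ ℚ.+-identityˡ (⅛ ℚ.* δ) ⟩
      ⅛ ℚ.* δ              ∎))
    where
    open ℚ.≤-Reasoning
    0≤r : 0ℚ ℚ.≤ r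
    0≤r = ℚ.≤-trans (ℚ.<⇒≤ 0<δ) (subst (ℚ._≤ r) (ℚ.+-identityˡ δ) δ≤r)

  contra : ⊥₀
  contra with N , k ← eventually-map₂ (λ t (e≤ , δ≤) → absurd-at (seq ε t) (seq q t) e≤ δ≤)
                        (eventually-map₂ (λ _ → _,_) (ε≤½ ¼ (ℚ.positive⁻¹ ¼)) δ≤q) (h (⅛ ℚ.* δ) 0<⅛δ)
    = k N ℕ.≤-refl

-- Relative approximation is exact on the kernel of A, so a sketch cannot
-- confuse A with a matrix whose kernel does not contain that of A.
Separated : ∀ {n} (A B : Matrix n) → Set
Separated A B = ∃[ x ] (∀ t → seq (quad A x) t ≡ 0ℚ) × 0ℝ < quad B x

module _ {n} {𝒜 : Pred (Matrix n) 0ℓ} (S : Sketch 𝒜) (ε p : ℝ) (ε≤½ : ε ≤ fromℚ ½)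
         (guarantee : Sketch.ForAllGuarantee S ε p) (s : ℕ) (space : Sketch.Space≤ S s) where

  open Sketch S
  open Counting randomness

  private
    success : ∃[ A ] 𝒜 A → Event
    success (A , a) = proj₁ (guarantee A a) ,, proj₁ (proj₂ (guarantee A a))

    code : Ω → ∃[ A ] 𝒜 A → List Bool
    code ω (A , a) = sk A a ω

    -- Equal codes at ω give equal estimates at x, since the shared bits agree as well. The upper
    -- bound for A makes this estimate at most 0, and the lower bound for B makes it positive.
    codes-differ : ∀ ω Aa Bb → Separated (proj₁ Aa) (proj₁ Bb) →
      Event.holds (success Aa) ω → Event.holds (success Bb) ω → code ω Aa ≢ code ω Bb
    codes-differ ω (A , a) (B , b) (x , Ax≡0 , 0<Bx) eA eB same =
      1-ε*q≰0 ε (quad B x) ε≤½ 0<Bx (begin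
        (1ℝ - ε) * quad B x           ≲⟨ proj₁ (proj₁ (proj₂ (proj₂ (guarantee B b))) eB x) ⟩
        est x (sk B b ω) (shared ω)   ≡⟨ cong (λ c → est x c (shared ω)) same ⟨
        est x (sk A a ω) (shared ω)   ≲⟨ proj₂ (proj₁ (proj₂ (proj₂ (guarantee A a))) eA x) ⟩
        -- The form vanishes in every term of its sequence, so the product does too, without any
        -- estimate of ε.
        (1ℝ + ε) * quad A x           ≲⟨ pointwise-≤ ((1ℝ + ε) * quad A x) 0ℝ (λ t → ℚ.≤-reflexive
                                           (trans (cong ((1ℚ ℚ.+ seq ε t) ℚ.*_) (Ax≡0 t))
                                                  (ℚ.*-zeroʳ (1ℚ ℚ.+ seq ε t)))) ⟩
        0ℝ                            ∎)
      where open PreorderReasoning ≤-preorder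

  separated-family-bound : ∀ (As : List (∃[ A ] 𝒜 A)) →
    AllPairs (λ Aa Bb → Separated (proj₁ Aa) (proj₁ Bb)) As →
    length As · p ≤ length (strings s) · 1ℝ
  separated-family-bound As sep = subst (λ m → m · p ≤ length (strings s) · 1ℝ) (length-map success As)
    (average-bound (length (strings s)) p (map success As)
      (All.map⁺ (All.universal (λ (A , a) → proj₂ (proj₂ (proj₂ (guarantee A a)))) As))
      (λ ω → pigeonhole success (code ω) (length (strings s)) (strings s) As ℕ.≤-refl
        (All.universal (λ (A , a) _ → ∈-strings s (sk A a ω) (space A a ω)) As)
        (AllPairs.map (λ {Aa} {Bb} → codes-differ ω Aa Bb) sep)))

-- Gram matrices of Boolean matrices

p≢0⇒0<p² : ∀ p → p ≢ 0ℚ → 0ℚ ℚ.< p ℚ.* p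
p≢0⇒0<p² p p≢0 with ℚ.<-cmp p 0ℚ
... | tri< p<0 _ _ = ℚ.positive⁻¹ (p ℚ.* p) {{ℚ.neg*neg⇒pos p {{ℚ.negative p<0}} p {{ℚ.negative p<0}}}}
... | tri≈ _ p≡0 _ = contradiction p≡0 p≢0
... | tri> _ _ 0<p = ℚ.positive⁻¹ (p ℚ.* p) {{ℚ.pos*pos⇒pos p {{ℚ.positive 0<p}} p {{ℚ.positive 0<p}}}}

0≤p² : ∀ p → 0ℚ ℚ.≤ p ℚ.* p
0≤p² p with p ℚ.≟ 0ℚ
... | yes refl = ℚ.≤-refl
... | no  p≢0  = ℚ.<⇒≤ (p≢0⇒0<p² p p≢0)

sum-nonneg : ∀ {n} (f : Vector ℚ n) → (∀ i → 0ℚ ℚ.≤ f i) → 0ℚ ℚ.≤ sum f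
sum-nonneg {zero}  f 0≤f = ℚ.≤-refl
sum-nonneg {suc n} f 0≤f = ℚ.+-mono-≤ (0≤f zero) (sum-nonneg (f ∘ suc) (0≤f ∘ suc))

sum-positive : ∀ {n} (f : Vector ℚ n) → (∀ i → 0ℚ ℚ.≤ f i) → ∀ i → 0ℚ ℚ.< f i → 0ℚ ℚ.< sum f
sum-positive f 0≤f zero    0<fi = ℚ.+-mono-<-≤ 0<fi (sum-nonneg (f ∘ suc) (0≤f ∘ suc))
sum-positive f 0≤f (suc i) 0<fi = ℚ.+-mono-≤-< (0≤f zero) (sum-positive (f ∘ suc) (0≤f ∘ suc) i 0<fi)

sum-++ : ∀ {m n} (f : Vector ℚ m) (g : Vector ℚ n) → sum (f Vector.++ g) ≡ sum f ℚ.+ sum g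
sum-++ {zero}  f g = sym (ℚ.+-identityˡ (sum g))
sum-++ {suc m} f g = begin
  f zero ℚ.+ sum (λ i → (f Vector.++ g) (suc i))
    ≡⟨ cong (f zero ℚ.+_) (sum-cong-≗ λ i → tail-++ i) ⟩
  f zero ℚ.+ sum ((f ∘ suc) Vector.++ g)
    ≡⟨ cong (f zero ℚ.+_) (sum-++ (f ∘ suc) g) ⟩
  f zero ℚ.+ (sum (f ∘ suc) ℚ.+ sum g)
    ≡⟨ ℚ.+-assoc (f zero) (sum (f ∘ suc)) (sum g) ⟨
  sum f ℚ.+ sum g ∎
  where
  open ≡-Reasoning
  tail-++ : ∀ i → (f Vector.++ g) (suc i) ≡ ((f ∘ suc) Vector.++ g) i
  tail-++ i with splitAt m i
  ... | inj₁ _ = refl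
  ... | inj₂ _ = refl

bit : Bool → ℚ
bit false = 0ℚ
bit true  = 1ℚ

bit-injective : ∀ b c → bit b ≡ bit c → b ≡ c
bit-injective false false _ = refl
bit-injective true  true  _ = refl

bit-∧ : ∀ b c → bit b ℚ.* bit c ≡ bit (b ∧ c)
bit-∧ false c = ℚ.*-zeroˡ (bit c)
bit-∧ true  c = ℚ.*-identityˡ (bit c)

sum-bits : ∀ {n} (f : Fin n → Bool) → ∃[ k ] k ℕ.≤ n × sum (bit ∘ f) ≡ + k / 1
sum-bits {zero}  f = 0 , ℕ.z≤n , refl
sum-bits {suc n} f with f zero | sum-bits (f ∘ suc)
... | false | k , k≤n , eq = k , ℕ.m≤n⇒m≤1+n k≤n , trans (ℚ.+-identityˡ _) eq
... | true  | k , k≤n , eq = suc k , ℕ.s≤s k≤n , trans (cong (1ℚ ℚ.+_) eq) (sym (suc/1 k))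

-- The Kronecker delta, Boolean so that it can fill the identity block of a `BoolMatrix`.
δ : ∀ {n} → Fin n → Fin n → Bool
δ i j = does (i Fin.≟ j)

sum-δ : ∀ {n} (i : Fin n) (f : Vector ℚ n) → sum (λ j → bit (δ i j) ℚ.* f j) ≡ f i
sum-δ {suc n} zero f = begin
  1ℚ ℚ.* f zero ℚ.+ sum (λ j → 0ℚ ℚ.* f (suc j))
    ≡⟨ cong₂ ℚ._+_ (ℚ.*-identityˡ (f zero))
         (trans (sum-cong-≗ λ j → ℚ.*-zeroˡ (f (suc j))) (sum-replicate-zero n)) ⟩
  f zero ℚ.+ 0ℚ
    ≡⟨ ℚ.+-identityʳ (f zero) ⟩
  f zero ∎
  where open ≡-Reasoning
sum-δ {suc n} (suc i) f = begin
  0ℚ ℚ.* f zero ℚ.+ sum (λ j → bit (δ i j) ℚ.* f (suc j))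
    ≡⟨ cong₂ ℚ._+_ (ℚ.*-zeroˡ (f zero)) (sum-δ i (f ∘ suc)) ⟩
  0ℚ ℚ.+ f (suc i)
    ≡⟨ ℚ.+-identityˡ (f (suc i)) ⟩
  f (suc i) ∎
  where open ≡-Reasoning

BoolMatrix : ℕ → ℕ → Set
BoolMatrix m n = Fin m → Fin n → Bool

apply : ∀ {m n} → BoolMatrix m n → Vector ℚ n → Vector ℚ m
apply R x r = sum λ j → bit (R r j) ℚ.* x j

gram : ∀ {m n} → BoolMatrix m n → Fin n → Fin n → ℚ
gram R i j = sum λ r → bit (R r i) ℚ.* bit (R r j)

quadℚ : ∀ {n} → (Fin n → Fin n → ℚ) → Vector ℚ n → ℚ
quadℚ A x = sum λ i → sum λ j → x i ℚ.* A i j ℚ.* x j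

-- With the sum over rows moved outermost, the double sum belonging to each row factors into a
-- square: the form of w RᵀR is w ‖R x‖².
quadℚ-gram : ∀ {m n} w (R : BoolMatrix m n) x →
  quadℚ (λ i j → w ℚ.* gram R i j) x ≡ w ℚ.* sum (λ r → apply R x r ℚ.* apply R x r)
quadℚ-gram w R x = begin
  sum (λ i → sum λ j → x i ℚ.* (w ℚ.* gram R i j) ℚ.* x j)
    ≡⟨ sum-cong-≗ (λ i → sum-cong-≗ λ j → expand i j) ⟩
  sum (λ i → sum λ j → sum λ r → term r i j)
    ≡⟨ sum-cong-≗ (λ i → ∑-comm (λ j r → term r i j)) ⟩
  sum (λ i → sum λ r → sum λ j → term r i j)
    ≡⟨ ∑-comm (λ i r → sum λ j → term r i j) ⟩
  sum (λ r → sum λ i → sum λ j → term r i j)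
    ≡⟨ sum-cong-≗ (λ r → collect r) ⟩
  sum (λ r → w ℚ.* (apply R x r ℚ.* apply R x r))
    ≡⟨ *-distribˡ-sum w (λ r → apply R x r ℚ.* apply R x r) ⟨
  w ℚ.* sum (λ r → apply R x r ℚ.* apply R x r) ∎
  where
  open ≡-Reasoning
  entry : ∀ r j → ℚ
  entry r j = bit (R r j) ℚ.* x j

  term : ∀ r i j → ℚ
  term r i j = w ℚ.* (entry r i ℚ.* entry r j)

  expand : ∀ i j → x i ℚ.* (w ℚ.* gram R i j) ℚ.* x j ≡ sum (λ r → term r i j)
  expand i j = begin
    x i ℚ.* (w ℚ.* gram R i j) ℚ.* x j
      ≡⟨ solve 4 (λ a w g b → a :* (w :* g) :* b := (w :* a :* b) :* g) refl (x i) w (gram R i j) (x j) ⟩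
    (w ℚ.* x i ℚ.* x j) ℚ.* gram R i j
      ≡⟨ *-distribˡ-sum (w ℚ.* x i ℚ.* x j) (λ r → bit (R r i) ℚ.* bit (R r j)) ⟩
    sum (λ r → (w ℚ.* x i ℚ.* x j) ℚ.* (bit (R r i) ℚ.* bit (R r j)))
      ≡⟨ sum-cong-≗ (λ r → solve 5 (λ w a b p q → (w :* a :* b) :* (p :* q) := w :* ((p :* a) :* (q :* b)))
           refl w (x i) (x j) (bit (R r i)) (bit (R r j))) ⟩
    sum (λ r → term r i j) ∎

  collect : ∀ r → sum (λ i → sum λ j → term r i j) ≡ w ℚ.* (apply R x r ℚ.* apply R x r)
  collect r = begin
    sum (λ i → sum λ j → w ℚ.* (entry r i ℚ.* entry r j))
      ≡⟨ sum-cong-≗ (λ i → *-distribˡ-sum w (λ j → entry r i ℚ.* entry r j)) ⟨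
    sum (λ i → w ℚ.* sum (λ j → entry r i ℚ.* entry r j))
      ≡⟨ *-distribˡ-sum w (λ i → sum λ j → entry r i ℚ.* entry r j) ⟨
    w ℚ.* sum (λ i → sum λ j → entry r i ℚ.* entry r j)
      ≡⟨ cong (w ℚ.*_) (sum-cong-≗ λ i → *-distribˡ-sum (entry r i) (entry r)) ⟨
    w ℚ.* sum (λ i → entry r i ℚ.* apply R x r)
      ≡⟨ cong (w ℚ.*_) (*-distribʳ-sum (apply R x r) (entry r)) ⟨
    w ℚ.* (apply R x r ℚ.* apply R x r) ∎

seq-∑ : ∀ {n} (f : Vector ℝ n) t → seq (∑ f) t ≡ sum (λ i → seq (f i) t)
seq-∑ {zero}  f t = refl
seq-∑ {suc n} f t = cong (seq (f zero) t ℚ.+_) (seq-∑ (f ∘ suc) t)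

-- Real addition and multiplication act term by term, so identities of rational forms transfer to
-- real queries at each index without passing to a limit.
seq-quad : ∀ {n} (A : Matrix n) x t →
  seq (quad A x) t ≡ quadℚ (λ i j → seq (A i j) t) (λ i → seq (x i) t)
seq-quad A x t = trans (seq-∑ (λ i → ∑ λ j → x i * A i j * x j) t)
  (sum-cong-≗ λ i → seq-∑ (λ j → x i * A i j * x j) t)

gramℝ : ∀ {m n} → ℚ → BoolMatrix m n → Matrix n
gramℝ w R i j = fromℚ (w ℚ.* gram R i j)

seq-quad-gramℝ : ∀ {m n} w (R : BoolMatrix m n) x t →
  let y = apply R (λ i → seq (x i) t) in
  seq (quad (gramℝ w R) x) t ≡ w ℚ.* sum (λ r → y r ℚ.* y r)
seq-quad-gramℝ w R x t = trans (seq-quad (gramℝ w R) x t) (quadℚ-gram w R (λ i → seq (x i) t))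

gramℝ-psd : ∀ {m n} w .{{_ : ℚ.NonNegative w}} (R : BoolMatrix m n) → PositiveSemidefinite (gramℝ w R)
gramℝ-psd w R = symmetric , nonneg
  where
  symmetric : ∀ i j → gramℝ w R i j ≈ gramℝ w R j i
  symmetric i j = pointwise-≈ (gramℝ w R i j) (gramℝ w R j i) λ _ →
    cong (w ℚ.*_) (sum-cong-≗ λ r → ℚ.*-comm (bit (R r i)) (bit (R r j)))

  nonneg : ∀ x → 0ℝ ≤ quad (gramℝ w R) x
  nonneg x = pointwise-≤ 0ℝ (quad (gramℝ w R) x) λ t →
    subst₂ ℚ._≤_ (ℚ.*-zeroʳ w) (sym (seq-quad-gramℝ w R x t))
      (ℚ.*-monoˡ-≤-nonNeg w (sum-nonneg _ λ r → 0≤p² (apply R (λ i → seq (x i) t) r)))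

-- The numbers of rows are independent, which admits the zero matrix as a Gram matrix with no rows.
gramℝ-separated : ∀ {l m n} w .{{_ : ℚ.Positive w}} (Q : BoolMatrix l n) (R : BoolMatrix m n) x →
  (∀ i → apply Q x i ≡ 0ℚ) → ∀ r → apply R x r ≢ 0ℚ → Separated (gramℝ w Q) (gramℝ w R)
gramℝ-separated {l} w Q R x Qx≡0 r Rx≢0 = fromℚ ∘ x , zero-form , positive-form
  where
  form-positive : 0ℚ ℚ.< w ℚ.* sum (λ i → apply R x i ℚ.* apply R x i)
  form-positive = ℚ.positive⁻¹ _ {{ℚ.pos*pos⇒pos w _ {{ℚ.positive
    (sum-positive (λ i → apply R x i ℚ.* apply R x i) (λ i → 0≤p² (apply R x i)) r (p≢0⇒0<p² _ Rx≢0))}}}}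

  zero-form : ∀ t → seq (quad (gramℝ w Q) (fromℚ ∘ x)) t ≡ 0ℚ
  zero-form t = begin
    seq (quad (gramℝ w Q) (fromℚ ∘ x)) t
      ≡⟨ seq-quad-gramℝ w Q (fromℚ ∘ x) t ⟩
    w ℚ.* sum (λ i → apply Q x i ℚ.* apply Q x i)
      ≡⟨ cong (w ℚ.*_) (sum-cong-≗ {l} λ i → cong₂ ℚ._*_ (Qx≡0 i) (Qx≡0 i)) ⟩
    w ℚ.* sum {l} (λ _ → 0ℚ)
      ≡⟨ cong (w ℚ.*_) (sum-replicate-zero l) ⟩
    w ℚ.* 0ℚ
      ≡⟨ ℚ.*-zeroʳ w ⟩
    0ℚ ∎
    where open ≡-Reasoning

  positive-form : 0ℝ < quad (gramℝ w R) (fromℚ ∘ x)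
  positive-form = _ , form-positive , 0 , λ t _ → ℚ.≤-reflexive
    (trans (ℚ.+-identityˡ _) (sym (seq-quad-gramℝ w R (fromℚ ∘ x) t)))

-- Grid points are counted from -1 in steps of 1/N, which shifts the index `k * p` by N.
scaled-grid-point : ∀ N .{{_ : ℕ.NonZero N}} p k →
  (+ p / N) ℚ.* (+ k / 1) ≡ ℚ.- 1ℚ ℚ.+ + (N ℕ.+ k ℕ.* p) / N
scaled-grid-point N@(suc M) p k = ℚ.toℚᵘ-injective (begin-equality
  ℚ.toℚᵘ ((+ p / N) ℚ.* (+ k / 1))                ≃⟨ ℚ.toℚᵘ-homo-* (+ p / N) (+ k / 1) ⟩
  ℚ.toℚᵘ (+ p / N) ℚᵘ.* ℚ.toℚᵘ (+ k / 1)          ≃⟨ ℚᵘ.*-cong (ℚ.toℚᵘ-fromℚᵘ (ℚᵘ.mkℚᵘ (+ p) M))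
                                                              (ℚ.toℚᵘ-fromℚᵘ (ℚᵘ.mkℚᵘ (+ k) 0)) ⟩
  ℚᵘ.mkℚᵘ (+ p) M ℚᵘ.* ℚᵘ.mkℚᵘ (+ k) 0            ≃⟨ ℚᵘ.*≡* cross ⟩
  ℚᵘ.- ℚᵘ.1ℚᵘ ℚᵘ.+ ℚᵘ.mkℚᵘ (+ (N ℕ.+ k ℕ.* p)) M  ≃⟨ ℚᵘ.+-congʳ (ℚᵘ.- ℚᵘ.1ℚᵘ) (ℚ.toℚᵘ-fromℚᵘ (ℚᵘ.mkℚᵘ (+ (N ℕ.+ k ℕ.* p)) M)) ⟨
  ℚ.toℚᵘ (ℚ.- 1ℚ) ℚᵘ.+ ℚ.toℚᵘ (+ (N ℕ.+ k ℕ.* p) / N)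
    ≃⟨ ℚ.toℚᵘ-homo-+ (ℚ.- 1ℚ) (+ (N ℕ.+ k ℕ.* p) / N) ⟨
  ℚ.toℚᵘ (ℚ.- 1ℚ ℚ.+ + (N ℕ.+ k ℕ.* p) / N)       ∎)
  where
  open ℚᵘ.≤-Reasoning
  open ℤ.+-*-Solver renaming (solve to solveℤ; _:=_ to _⊜_; _:+_ to _⊕_; _:*_ to _⊗_; con to κ)
  -- The numerator `+ (N + k * p)` is no integer polynomial to the solver, so it enters as a
  -- variable with an equation.
  cross-ℤ : ∀ p k m i → i ≡ m ℤ.+ k ℤ.* p →
    (p ℤ.* k) ℤ.* (+ 1 ℤ.* m) ≡ (ℤ.- + 1 ℤ.* m ℤ.+ i ℤ.* + 1) ℤ.* (m ℤ.* + 1)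
  cross-ℤ p k m _ refl = solveℤ 3 (λ p k m → (p ⊗ k) ⊗ (κ (+ 1) ⊗ m) ⊜
    (κ (ℤ.- + 1) ⊗ m ⊕ (m ⊕ k ⊗ p) ⊗ κ (+ 1)) ⊗ (m ⊗ κ (+ 1))) refl p k m

  cross : (+ p ℤ.* + k) ℤ.* (+ 1 ℤ.* + N) ≡
          (ℤ.- + 1 ℤ.* + N ℤ.+ + (N ℕ.+ k ℕ.* p) ℤ.* + 1) ℤ.* (+ N ℤ.* + 1)
  cross = cross-ℤ (+ p) (+ k) (+ N) (+ (N ℕ.+ k ℕ.* p))
    (trans (ℤ.pos-+ N (k ℕ.* p)) (cong (λ i → + N ℤ.+ i) (ℤ.pos-* k p)))

-- The matrices with kernels { (- X v, v) }

module Family (a b C′ : ℕ) where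
  private
    -- An exponent of at least 1 makes 1/n = n^C′ / n^C a multiple of the grid step; `suc a` gives
    -- every [ I X ] a row.
    n C N : ℕ
    n = suc a ℕ.+ b
    C = suc C′
    N = n ℕ.^ C

    instance
      N≢0 : ℕ.NonZero N
      N≢0 = ℕ.m^n≢0 n C

  -- 1 / n, written with the denominator of the grid.
  scale : ℚ
  scale = + (n ℕ.^ C′) / N

  instance
    scale-positive : ℚ.Positive scale
    scale-positive = ℚ.normalize-pos (n ℕ.^ C′) N {{N≢0}} {{ℕ.m^n≢0 n C′}}

  gram-admissible : ∀ {m} → m ℕ.≤ n → (R : BoolMatrix m n) → Admissible n C (gramℝ scale R)
  gram-admissible m≤n R = gramℝ-psd scale {{ℚ.pos⇒nonNeg scale}} R , on-grid
    where
    on-grid : ∀ i j → Grid N (gramℝ scale R i j)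
    -- The Gram entry counts the rows in which columns i and j are both 1. There are at most n rows,
    -- so division by n brings it into [0, 1].
    on-grid i j with k , k≤m , eq ← sum-bits (λ r → R r i ∧ R r j) =
      N ℕ.+ k ℕ.* n ℕ.^ C′
      , ℕ.+-monoʳ-≤ N (ℕ.≤-trans (ℕ.*-monoˡ-≤ (n ℕ.^ C′) (ℕ.≤-trans k≤m m≤n))
                                 (ℕ.≤-reflexive (sym (ℕ.+-identityʳ N))))
      , pointwise-≈ (gramℝ scale R i j) (fromℚ (ℚ.- 1ℚ ℚ.+ + (N ℕ.+ k ℕ.* n ℕ.^ C′) / N)) λ _ → begin
          scale ℚ.* gram R i j
            ≡⟨ cong (scale ℚ.*_) (trans (sum-cong-≗ λ r → bit-∧ (R r i) (R r j)) eq) ⟩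
          scale ℚ.* (+ k / 1)
            ≡⟨ scaled-grid-point N (n ℕ.^ C′) k ⟩
          ℚ.- 1ℚ ℚ.+ + (N ℕ.+ k ℕ.* n ℕ.^ C′) / N ∎
      where open ≡-Reasoning

  private
    column : Vec Bool (suc a ℕ.* b) → Fin b → Fin (suc a) → Bool
    column X j i = lookup X (combine i j)

  -- The block matrix [ I X ], with X stored row by row.
  identity∣ : Vec Bool (suc a ℕ.* b) → BoolMatrix (suc a) n
  identity∣ X i = δ i Vector.++ λ j → column X j i

  -- The vector (- X eⱼ, eⱼ), in the kernel of [ I X ].
  kernel-vector : Vec Bool (suc a ℕ.* b) → Fin b → Vector ℚ n
  kernel-vector X j = (λ i → ℚ.- bit (column X j i)) Vector.++ λ l → bit (δ j l)

  -- The result is entry i of (Y - X) eⱼ. It serves twice: for Y = X it shows membership in the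
  -- kernel, and otherwise it detects a difference in column j.
  apply-kernel-vector : ∀ X Y j i →
    apply (identity∣ Y) (kernel-vector X j) i ≡ ℚ.- bit (column X j i) ℚ.+ bit (column Y j i)
  apply-kernel-vector X Y j i = begin
    sum (λ k → bit (identity∣ Y i k) ℚ.* kernel-vector X j k)
      ≡⟨ sum-cong-≗ blocks ⟩
    sum (left Vector.++ right)
      ≡⟨ sum-++ left right ⟩
    sum left ℚ.+ sum right
      ≡⟨ cong₂ ℚ._+_ (sum-δ i (λ k → ℚ.- bit (column X j k)))
           (trans (sum-cong-≗ λ l → ℚ.*-comm (bit (column Y l i)) (bit (δ j l)))
                  (sum-δ j (λ l → bit (column Y l i)))) ⟩
    ℚ.- bit (column X j i) ℚ.+ bit (column Y j i) ∎
    where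
    open ≡-Reasoning
    left : Vector ℚ (suc a)
    left k = bit (δ i k) ℚ.* (ℚ.- bit (column X j k))

    right : Vector ℚ b
    right l = bit (column Y l i) ℚ.* bit (δ j l)

    blocks : ∀ k → bit (identity∣ Y i k) ℚ.* kernel-vector X j k ≡ (left Vector.++ right) k
    blocks k with splitAt (suc a) k
    ... | inj₁ _ = refl
    ... | inj₂ _ = refl

  Member : Set
  Member = ∃[ A ] Admissible n C A

  no-rows : BoolMatrix 0 n
  no-rows ()

  zero-member : Member
  zero-member = gramℝ scale no-rows , gram-admissible ℕ.z≤n no-rows

  member : Vec Bool (suc a ℕ.* b) → Member
  member X = gramℝ scale (identity∣ X) , gram-admissible (ℕ.m≤m+n (suc a) b) (identity∣ X)

  -- Every vector lies in the kernel of the zero matrix. The first unit vector serves as the query,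
  -- since the identity block makes the first entry of its image 1.
  zero-separated : ∀ X → Separated (proj₁ zero-member) (proj₁ (member X))
  zero-separated X = gramℝ-separated scale no-rows (identity∣ X) (λ k → bit (δ zero k)) (λ ()) zero
    λ eq → from-no (1ℚ ℚ.≟ 0ℚ) (begin
      1ℚ
        ≡⟨ sum-δ zero (λ k → bit (identity∣ X zero k)) ⟨
      sum (λ k → bit (δ zero k) ℚ.* bit (identity∣ X zero k))
        ≡⟨ sum-cong-≗ (λ k → ℚ.*-comm (bit (δ zero k)) (bit (identity∣ X zero k))) ⟩
      apply (identity∣ X) (λ k → bit (δ zero k)) zero
        ≡⟨ eq ⟩
      0ℚ ∎)
    where open ≡-Reasoning

  columns-separated : ∀ X Y i j → column X j i ≢ column Y j i →
    Separated (proj₁ (member X)) (proj₁ (member Y))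
  columns-separated X Y i j Xij≢Yij =
    gramℝ-separated scale (identity∣ X) (identity∣ Y) (kernel-vector X j)
      (λ r → trans (apply-kernel-vector X X j r) (ℚ.+-inverseˡ (bit (column X j r)))) i
      λ eq → Xij≢Yij (bit-injective (column X j i) (column Y j i)
        (-p+q≡0⇒p≡q (bit (column X j i)) (bit (column Y j i))
          (trans (sym (apply-kernel-vector X Y j i)) eq)))
    where
    -p+q≡0⇒p≡q : ∀ p q → ℚ.- p ℚ.+ q ≡ 0ℚ → p ≡ q
    -p+q≡0⇒p≡q p q eq = begin
      p                     ≡⟨ ℚ.+-identityʳ p ⟨
      p ℚ.+ 0ℚ              ≡⟨ cong (p ℚ.+_) eq ⟨
      p ℚ.+ (ℚ.- p ℚ.+ q)   ≡⟨ solve 2 (λ p q → p :+ (:- p :+ q) := q) refl p q ⟩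
      q                     ∎
      where open ≡-Reasoning

  member-separated : ∀ X Y → ∃[ k ] lookup X k ≢ lookup Y k →
    Separated (proj₁ (member X)) (proj₁ (member Y))
  member-separated X Y (k , Xk≢Yk) =
    let i , j , ij≡k = Fin.combine-surjective {suc a} {b} k
    in columns-separated X Y i j (subst (λ k → lookup X k ≢ lookup Y k) (sym ij≡k) Xk≢Yk)

-- Enumeration of Boolean words

words : ∀ k → List (Vec Bool k)
words zero    = [] ∷ []
words (suc k) = map (true ∷_) (words k) ++ map (false ∷_) (words k)

length-words : ∀ k → length (words k) ≡ 2 ℕ.^ k
length-words zero    = refl
length-words (suc k) = begin
  length (map (true ∷_) (words k) ++ map (false ∷_) (words k))
    ≡⟨ length-++ (map (true ∷_) (words k)) ⟩
  length (map (true ∷_) (words k)) ℕ.+ length (map (false ∷_) (words k))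
    ≡⟨ cong₂ ℕ._+_ (trans (length-map (true ∷_) (words k)) (length-words k))
         (trans (length-map (false ∷_) (words k)) (trans (length-words k) (sym (ℕ.+-identityʳ _)))) ⟩
  2 ℕ.^ suc k ∎
  where open ≡-Reasoning

-- A position is recorded, not mere inequality, because the column of the differing entry determines
-- the query.
words-differ : ∀ k → AllPairs (λ v w → ∃[ i ] lookup v i ≢ lookup w i) (words k)
words-differ zero    = [] ∷ []
words-differ (suc k) = AllPairs.++⁺
  (AllPairs.map⁺ (AllPairs.map (λ (i , ≢) → suc i , ≢) (words-differ k)))
  (AllPairs.map⁺ (AllPairs.map (λ (i , ≢) → suc i , ≢) (words-differ k)))
  (All.map⁺ (All.universal (λ _ → All.map⁺ (All.universal (λ _ → zero , λ ()) (words k))) (words k)))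

-- Arithmetic of the bound

halves : ∀ n → ∃[ a ] ∃[ b ] suc n ≡ suc a ℕ.+ b × (suc a ≡ b ⊎ a ≡ b)
halves zero = 0 , 0 , refl , inj₂ refl
halves (suc n) with halves n
... | a , b , eq , inj₁ refl = suc a , suc a , cong suc eq , inj₂ refl
... | a , b , eq , inj₂ refl = a , suc a , trans (cong suc eq) (cong suc (sym (ℕ.+-suc a a))) , inj₁ refl

-- A balanced split gives ⌊n²/4⌋ free entries; the summand 1 is the remainder for odd n.
square≤ : ∀ a b → suc a ≡ b ⊎ a ≡ b → (suc a ℕ.+ b) ℕ.^ 2 ℕ.≤ 4 ℕ.* (suc a ℕ.* b) ℕ.+ 1
square≤ a b (inj₁ refl) = ℕ.≤-trans (ℕ.≤-reflexive (solveℕ 1 (λ x → (x ⊕ x) ⊛ 2 ⊜ κ 4 ⊗ (x ⊗ x)) refl (suc a)))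
  (ℕ.m≤m+n _ 1)
  where open ℕ.+-*-Solver renaming (solve to solveℕ; _:=_ to _⊜_; _:+_ to _⊕_; _:*_ to _⊗_; _:^_ to _⊛_; con to κ)
square≤ a b (inj₂ refl) = ℕ.≤-reflexive
  (solveℕ 1 (λ x → (κ 1 ⊕ x ⊕ x) ⊛ 2 ⊜ κ 4 ⊗ ((κ 1 ⊕ x) ⊗ x) ⊕ κ 1) refl a)
  where open ℕ.+-*-Solver renaming (solve to solveℕ; _:=_ to _⊜_; _:+_ to _⊕_; _:*_ to _⊗_; _:^_ to _⊛_; con to κ)

-- If k ≥ s + 2, then even 9/10 of 2^k exceeds the number 2^(s+1) - 1 of codes.
counting⇒exponent≤ : ∀ k s → (1 ℕ.+ 2 ℕ.^ k) ℕ.* 9 ℕ.≤ length (strings s) ℕ.* 10 → k ℕ.≤ suc s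
counting⇒exponent≤ k s h = ℕ.≮⇒≥ λ 2+s≤k → ℕ.<-irrefl refl (begin-strict
  length (strings s) ℕ.* 10                    ≤⟨ ℕ.*-monoʳ-≤ (length (strings s)) {10} {18} (ℕ.m≤m+n 10 8) ⟩
  length (strings s) ℕ.* 18                    <⟨ ℕ.m<m+n _ (ℕ.s≤s ℕ.z≤n) ⟩
  length (strings s) ℕ.* 18 ℕ.+ 27
    ≡⟨ solveℕ 1 (λ l → l ⊗ κ 18 ⊕ κ 27 ⊜ (κ 1 ⊕ κ 2 ⊗ (κ 1 ⊕ l)) ⊗ κ 9) refl (length (strings s)) ⟩
  (1 ℕ.+ 2 ℕ.* suc (length (strings s))) ℕ.* 9 ≡⟨ cong (λ m → (1 ℕ.+ 2 ℕ.* m) ℕ.* 9) (length-strings s) ⟩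
  (1 ℕ.+ 2 ℕ.^ suc (suc s)) ℕ.* 9              ≤⟨ ℕ.*-monoˡ-≤ 9 (ℕ.s≤s (ℕ.^-monoʳ-≤ 2 2+s≤k)) ⟩
  (1 ℕ.+ 2 ℕ.^ k) ℕ.* 9                        ≤⟨ h ⟩
  length (strings s) ℕ.* 10                    ∎)
  where
  open ℕ.≤-Reasoning
  open ℕ.+-*-Solver renaming (solve to solveℕ; _:=_ to _⊜_; _:+_ to _⊕_; _:*_ to _⊗_; con to κ)

-- Without space there is one code for at least two matrices, and 18 > 10. For n = 1, where k = 0,
-- the bound on the exponent says nothing and this one is decisive.
counting⇒space≢0 : ∀ k s → (1 ℕ.+ 2 ℕ.^ k) ℕ.* 9 ℕ.≤ length (strings s) ℕ.* 10 → 0 ℕ.< s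
counting⇒space≢0 k (suc s) _ = ℕ.s≤s ℕ.z≤n
counting⇒space≢0 k zero    h = contradiction
  (ℕ.≤-trans (ℕ.*-monoˡ-≤ 9 (ℕ.s≤s (ℕ.m^n>0 2 k))) h) (from-no (18 ℕ.≤? 10))

toℚᵘ-/1 : ∀ k → ℚ.toℚᵘ (+ k / 1) ℚᵘ.≃ ℚᵘ.mkℚᵘ (+ k) 0
toℚᵘ-/1 k = ℚ.toℚᵘ-fromℚᵘ (ℚᵘ.mkℚᵘ (+ k) 0)

/1-mono-≤ : ∀ {p q} → p ℕ.≤ q → + p / 1 ℚ.≤ + q / 1
/1-mono-≤ {p} {q} p≤q = ℚ.toℚᵘ-cancel-≤ (begin
  ℚ.toℚᵘ (+ p / 1)   ≃⟨ toℚᵘ-/1 p ⟩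
  ℚᵘ.mkℚᵘ (+ p) 0    ≤⟨ ℚᵘ.*≤* (ℤ.*-monoʳ-≤-nonNeg (+ 1) (ℤ.+≤+ p≤q)) ⟩
  ℚᵘ.mkℚᵘ (+ q) 0    ≃⟨ toℚᵘ-/1 q ⟨
  ℚ.toℚᵘ (+ q / 1)   ∎)
  where open ℚᵘ.≤-Reasoning

/1-cancel-≤ : ∀ {p q} → + p / 1 ℚ.≤ + q / 1 → p ℕ.≤ q
/1-cancel-≤ {p} {q} h = ℤ.drop‿+≤+
  (subst₂ ℤ._≤_ (ℤ.*-identityʳ (+ p)) (ℤ.*-identityʳ (+ q)) (ℚᵘ.drop-*≤* (begin
    ℚᵘ.mkℚᵘ (+ p) 0    ≃⟨ toℚᵘ-/1 p ⟨
    ℚ.toℚᵘ (+ p / 1)   ≤⟨ ℚ.toℚᵘ-mono-≤ h ⟩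
    ℚ.toℚᵘ (+ q / 1)   ≃⟨ toℚᵘ-/1 q ⟩
    ℚᵘ.mkℚᵘ (+ q) 0    ∎)))
  where open ℚᵘ.≤-Reasoning

/1-* : ∀ p q → + (p ℕ.* q) / 1 ≡ (+ p / 1) ℚ.* (+ q / 1)
/1-* p q = ℚ.toℚᵘ-injective (begin-equality
  ℚ.toℚᵘ (+ (p ℕ.* q) / 1)                  ≃⟨ toℚᵘ-/1 (p ℕ.* q) ⟩
  ℚᵘ.mkℚᵘ (+ (p ℕ.* q)) 0                   ≃⟨ ℚᵘ.*≡* (cong (ℤ._* + 1) (ℤ.pos-* p q)) ⟩
  ℚᵘ.mkℚᵘ (+ p) 0 ℚᵘ.* ℚᵘ.mkℚᵘ (+ q) 0      ≃⟨ ℚᵘ.*-cong (toℚᵘ-/1 p) (toℚᵘ-/1 q) ⟨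
  ℚ.toℚᵘ (+ p / 1) ℚᵘ.* ℚ.toℚᵘ (+ q / 1)    ≃⟨ ℚ.toℚᵘ-homo-* (+ p / 1) (+ q / 1) ⟨
  ℚ.toℚᵘ ((+ p / 1) ℚ.* (+ q / 1))          ∎)
  where open ℚᵘ.≤-Reasoning

·-9/10≤·-1⇒*9≤*10 : ∀ M K → M · fromℚ (+ 9 / 10) ≤ K · 1ℝ → M ℕ.* 9 ℕ.≤ K ℕ.* 10
·-9/10≤·-1⇒*9≤*10 M K h = /1-cancel-≤ (begin
  + (M ℕ.* 9) / 1                           ≡⟨ /1-* M 9 ⟩
  (+ M / 1) ℚ.* ((+ 9 / 10) ℚ.* (+ 10 / 1)) ≡⟨ ℚ.*-assoc (+ M / 1) (+ 9 / 10) (+ 10 / 1) ⟨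
  (+ M / 1) ℚ.* (+ 9 / 10) ℚ.* (+ 10 / 1)   ≤⟨ ℚ.*-monoʳ-≤-nonNeg (+ 10 / 1) M*9/10≤K*1 ⟩
  (+ K / 1) ℚ.* 1ℚ ℚ.* (+ 10 / 1)           ≡⟨ ℚ.*-assoc (+ K / 1) 1ℚ (+ 10 / 1) ⟩
  (+ K / 1) ℚ.* (1ℚ ℚ.* (+ 10 / 1))         ≡⟨ /1-* K 10 ⟨
  + (K ℕ.* 10) / 1                          ∎)
  where
  open ℚ.≤-Reasoning
  M*9/10≤K*1 : (+ M / 1) ℚ.* (+ 9 / 10) ℚ.≤ (+ K / 1) ℚ.* 1ℚ
  M*9/10≤K*1 = fromℚ-cancel-≤
    (≤-trans (fromℚ ((+ M / 1) ℚ.* (+ 9 / 10))) (M · fromℚ (+ 9 / 10)) (fromℚ ((+ K / 1) ℚ.* 1ℚ))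
      (pointwise-≤ (fromℚ ((+ M / 1) ℚ.* (+ 9 / 10))) (M · fromℚ (+ 9 / 10))
        (λ t → ℚ.≤-reflexive (sym (·-fromℚ M (+ 9 / 10) t))))
      (≤-trans (M · fromℚ (+ 9 / 10)) (K · 1ℝ) (fromℚ ((+ K / 1) ℚ.* 1ℚ)) h
        (pointwise-≤ (K · 1ℝ) (fromℚ ((+ K / 1) ℚ.* 1ℚ)) (λ t → ℚ.≤-reflexive (·-fromℚ K 1ℚ t)))))

p≤9*q⇒1/9*p≤q : ∀ p q → p ℕ.≤ 9 ℕ.* q → fromℚ (+ 1 / 9) * fromℕ p ≤ fromℕ q
p≤9*q⇒1/9*p≤q p q p≤9*q = pointwise-≤ (fromℚ (+ 1 / 9) * fromℕ p) (fromℕ q) λ _ → begin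
  (+ 1 / 9) ℚ.* (+ p / 1)                 ≤⟨ ℚ.*-monoˡ-≤-nonNeg (+ 1 / 9) (/1-mono-≤ p≤9*q) ⟩
  (+ 1 / 9) ℚ.* (+ (9 ℕ.* q) / 1)         ≡⟨ cong ((+ 1 / 9) ℚ.*_) (/1-* 9 q) ⟩
  (+ 1 / 9) ℚ.* ((+ 9 / 1) ℚ.* (+ q / 1)) ≡⟨ ℚ.*-assoc (+ 1 / 9) (+ 9 / 1) (+ q / 1) ⟨
  1ℚ ℚ.* (+ q / 1)                        ≡⟨ ℚ.*-identityˡ (+ q / 1) ⟩
  + q / 1                                 ∎
  where open ℚ.≤-Reasoning

-- The quadratic lower bound

family-bound : ∀ a b C′ ε → ε ≤ fromℚ ½ → (S : Sketch (Admissible (suc a ℕ.+ b) (suc C′))) →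
  Sketch.ForAllGuarantee S ε (fromℚ (+ 9 / 10)) → ∀ s → Sketch.Space≤ S s →
  (1 ℕ.+ 2 ℕ.^ (suc a ℕ.* b)) ℕ.* 9 ℕ.≤ length (strings s) ℕ.* 10
family-bound a b C′ ε ε≤½ S guarantee s space =
  subst (λ m → suc m ℕ.* 9 ℕ.≤ length (strings s) ℕ.* 10)
    (trans (length-map member Xs) (length-words (suc a ℕ.* b)))
    (·-9/10≤·-1⇒*9≤*10 (length family) (length (strings s))
      (separated-family-bound S ε (fromℚ (+ 9 / 10)) ε≤½ guarantee s space family
        (All.map⁺ (All.universal zero-separated Xs) ∷
         AllPairs.map⁺ (AllPairs.map (λ {X} {Y} → member-separated X Y) (words-differ (suc a ℕ.* b))))))
  where
  open Family a b C′
  Xs = words (suc a ℕ.* b)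
  -- The zero matrix has to come first: `Separated` is directed, and the form of the zero matrix is
  -- positive nowhere.
  family = zero-member ∷ map member Xs

n²≤9s : ∀ C′ ε → ε ≤ fromℚ ½ → ∀ n (S : Sketch (Admissible n (suc C′))) →
  Sketch.ForAllGuarantee S ε (fromℚ (+ 9 / 10)) → ∀ s → Sketch.Space≤ S s →
  n ℕ.^ 2 ℕ.≤ 9 ℕ.* s
n²≤9s C′ ε ε≤½ zero S guarantee s space = ℕ.z≤n
n²≤9s C′ ε ε≤½ (suc n) S guarantee s space with a , b , refl , balanced ← halves n = begin
  (suc a ℕ.+ b) ℕ.^ 2                      ≤⟨ square≤ a b balanced ⟩
  4 ℕ.* (suc a ℕ.* b) ℕ.+ 1                ≤⟨ ℕ.+-monoˡ-≤ 1 (ℕ.*-monoʳ-≤ 4 (counting⇒exponent≤ (suc a ℕ.* b) s count)) ⟩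
  4 ℕ.* suc s ℕ.+ 1                        ≡⟨ solveℕ 1 (λ s → κ 4 ⊗ (κ 1 ⊕ s) ⊕ κ 1 ⊜ κ 4 ⊗ s ⊕ κ 5 ⊗ κ 1) refl s ⟩
  -- The additive 5 is absorbed by 5 s because s ≥ 1. This produces the 9 and hence c = 1/9.
  4 ℕ.* s ℕ.+ 5 ℕ.* 1                      ≤⟨ ℕ.+-monoʳ-≤ (4 ℕ.* s) (ℕ.*-monoʳ-≤ 5 (counting⇒space≢0 (suc a ℕ.* b) s count)) ⟩
  4 ℕ.* s ℕ.+ 5 ℕ.* s                      ≡⟨ ℕ.*-distribʳ-+ s 4 5 ⟨
  9 ℕ.* s                                  ∎
  where
  open ℕ.≤-Reasoning
  open ℕ.+-*-Solver renaming (solve to solveℕ; _:=_ to _⊜_; _:+_ to _⊕_; _:*_ to _⊗_; con to κ)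
  count = family-bound a b C′ ε ε≤½ S guarantee s space

theorem5p1 : ∃[ C₀ ] ∃[ ε₀ ] 0ℝ < ε₀ ×
    (∀ (C : ℕ) → C₀ ℕ.≤ C → 0 ℕ.< C →
    ∀ (ε : ℝ) → 0ℝ < ε → ε ≤ ε₀ →
    ∃[ c ] 0ℝ < c ×
    (∀ (n : ℕ) (S : Sketch (Admissible n C)) →
    Sketch.ForAllGuarantee S ε (fromℚ (+ 9 / 10)) →
    ∀ (s : ℕ) → Sketch.Space≤ S s →
    c * fromℕ (n ℕ.^ 2) ≤ fromℕ s))
-- C ≥ 1 puts multiples of 1/n on the grid, and ε ≤ ½ keeps 1 - ε away from 0.
theorem5p1 = 1 , fromℚ ½ , fromℚ-pos (ℚ.positive⁻¹ ½) , λ where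
  (suc C′) _ _ ε _ ε≤½ → fromℚ (+ 1 / 9) , fromℚ-pos (ℚ.positive⁻¹ (+ 1 / 9)) ,
    λ n S guarantee s space →
      p≤9*q⇒1/9*p≤q (n ℕ.^ 2) s (n²≤9s C′ ε ε≤½ n S guarantee s space)
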